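{- Fix a positive integer $r\geq 3$ and a real number $\varepsilon>0$. Then for all sufficiently large integers $k$ (depending on $r$ and $\varepsilon$), we have \[\operatorname{ind}_r(k,\ell)\leq \operatorname{ind}_{\leq r}(k,\ell)\leq 100\cdot \ell^{ -1/(2r)}\] for all integers $\ell$ with $1\leq \ell\leq (1-\varepsilon)k/r$.
   Context: A hypergraph has a finite vertex set and a set of edges, each edge being a non-empty subset of the vertex set. For a hypergraph $G$ with at least $k$ vertices, let $I(G,k,\ell)$ be the probability that a uniformly random $k$-vertex subset of $V(G)$ contains (as subsets) exactly $\ell$ edges of $G$. For $r\geq 1$ and $n\geq k$, let $I_r(n,k,\ell)$ be the maximum of $I(G,k,\ell)$ over all $r$-uniform hypergraphs $G$ on $n$ vertices, and $I_{\leq r}(n,k,\ell)$ the maximum of $I(G,k,\ell)$ over all hypergraphs $G$ on $n$ vertices all of whose edges have size at most $r$. Both are non-increasing in $n$; define $\operatorname{ind}_r(k,\ell)=\lim_{n\to\infty}I_r(n,k,\ell)$ and $\operatorname{ind}_{\leq r}(k,\ell)=\lim_{n\to\infty}I_{\leq r}(n,k,\ell)$. -}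

module Defs where

open import Data.Bool using (Bool; true; false; _∧_)
import Data.Bool
open import Data.Nat as ℕ using (ℕ; zero; suc; _≡ᵇ_)
open import Data.Nat.Combinatorics using (_C_)
open import Data.Integer using (+_)
open import Data.Rational using (ℚ; 0ℚ; 1ℚ; _+_; _*_; _≤_; _/_) renaming (_<_ to _<ℚ_)
open import Data.List using (List; []; _∷_; map; _++_; filter; length)
open import Data.Vec using (_∷_; [])
open import Data.Fin.Subset using (Subset; inside; outside; ∣_∣; _⊆_)
open import Data.Fin.Subset.Properties using (_⊆?_)
open import Data.Product using (Σ; ∃-syntax; _×_)
open import Relation.Binary.PropositionalEquality using (_≡_)
open import Relation.Nullary.Decidable using (⌊_⌋)
open import Relation.Unary using (Pred)

allSubsets : (n : ℕ) → List (Subset n)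
allSubsets zero = [] ∷ []
allSubsets (suc n) =
  map (outside ∷_) (allSubsets n) ++ map (inside ∷_) (allSubsets n)

kSubsets : (n k : ℕ) → List (Subset n)
kSubsets n k = filter (λ S → ∣ S ∣ ℕ.≟ k) (allSubsets n)

record Hypergraph (n : ℕ) : Set where
  field
    isEdge   : Subset n → Bool
    nonempty : ∀ s → isEdge s ≡ true → 1 ℕ.≤ ∣ s ∣
open Hypergraph public

Uniform : ∀ {n} → ℕ → Hypergraph n → Set
Uniform r G = ∀ s → isEdge G s ≡ true → ∣ s ∣ ≡ r

RankAtMost : ∀ {n} → ℕ → Hypergraph n → Set
RankAtMost r G = ∀ s → isEdge G s ≡ true → ∣ s ∣ ℕ.≤ r

edgesIn : ∀ {n} → Hypergraph n → Subset n → ℕ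
edgesIn {n} G S = length (filter (λ s → (isEdge G s ∧ ⌊ s ⊆? S ⌋) Data.Bool.≟ true) (allSubsets n))

-- a / b as a rational (0 if b = 0; only used with b > 0)
ratio : ℕ → ℕ → ℚ
ratio a zero = 0ℚ
ratio a (suc b) = (+ a) / suc b

I : ∀ {n} → Hypergraph n → ℕ → ℕ → ℚ
I {n} G k ℓ =
  ratio (length (filter (λ S → edgesIn G S ℕ.≟ ℓ) (kSubsets n k))) (n C k)

ι : ℕ → ℚ
ι m = (+ m) / 1

_^_ : ℚ → ℕ → ℚ
x ^ zero = 1ℚ
x ^ suc m = x * (x ^ m)

-- x is a nonnegative rational with x ≤ 100 · ℓ^(-1/(2r)),
-- i.e. x ≥ 0 and x^(2r) · ℓ ≤ 100^(2r)
BelowBound : ℕ → ℕ → ℚ → Set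
BelowBound r ℓ x = (0ℚ ≤ x) × ((x ^ (2 ℕ.* r)) * ι ℓ ≤ ι 100 ^ (2 ℕ.* r))

-- ind_{≤r}(k,ℓ) ≤ 100 · ℓ^(-1/(2r)).
-- Since I_{≤r}(n,k,ℓ) is non-increasing in n with limit ind_{≤r}(k,ℓ),
-- this holds iff for every δ > 0 there is n ≥ k with
-- I_{≤r}(n,k,ℓ) = max_G I(G,k,ℓ) ≤ 100 ℓ^(-1/(2r)) + δ.
IndAtMostBound : ℕ → ℕ → ℕ → Set
IndAtMostBound r k ℓ =
  ∀ (δ : ℚ) → 0ℚ <ℚ δ →
  ∃[ n ] ((k ℕ.≤ n) ×
    (∀ (G : Hypergraph n) → RankAtMost r G →
      ∃[ x ] (BelowBound r ℓ x × (I G k ℓ ≤ x + δ))))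

-- ind_r(k,ℓ) ≤ ind_{≤r}(k,ℓ).
-- For non-increasing sequences a,b: lim a ≤ lim b iff for every δ > 0 and
-- every m there is n with a(n) ≤ b(m) + δ.  With a(n) = I_r(n,k,ℓ) and
-- b(m) = I_{≤r}(m,k,ℓ) (maxima over finitely many hypergraphs, attained):
IndUniformLeIndAtMost : ℕ → ℕ → ℕ → Set
IndUniformLeIndAtMost r k ℓ =
  ∀ (δ : ℚ) → 0ℚ <ℚ δ → ∀ (m : ℕ) → k ℕ.≤ m →
  ∃[ n ] ((k ℕ.≤ n) ×
    (∀ (G : Hypergraph n) → Uniform r G →
      ∃[ H ] (RankAtMost {m} r H × (I G k ℓ ≤ I H k ℓ + δ))))

{-# OPTIONS --safe #-}
module Submission where

-- Let m be the number of non-isolated vertices of a k-set A with exactly ℓ edges.  Since the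
-- edges have size at most r, m is at most rℓ ≤ (1 - ε)k and at least of order r ℓ^(1/r).
--
-- Add the vertices in random order, and let h(t) be the probability that the first t of them
-- span exactly ℓ edges and m non-isolated vertices.  The edge count reaches ℓ at most once, and
-- given the event in h(t) it does so at time t with probability m / t; hence Σ m h(t) / t ≤ 1,
-- summed over t and m.  So it suffices that h(t) ≥ h(k) / 2 for all t in an interval of length
-- J ≈ k / √(rm) that starts or ends at k.
--
-- We have h(t+1) / h(t) = (1 - β(t)) / (1 - m / (t+1)), where β(t) is the probability that the
-- next vertex creates a new edge.  Cauchy–Schwarz for the pairs (K ∪ {x} , K ∪ {y}) of such sets,
-- together with the fact that a given new edge is destroyed by removing one of at most r
-- vertices, shows that β grows by a factor of at most 1 + O(r / (t - m)) per step.  Hence h falls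
-- slowly to the right of k if β(k-1) ≤ m / k, and slowly to the left of k otherwise.

open import Defs renaming (_^_ to _^ℚ_)
open import Data.Bool as Bool using (Bool; true; false; not; if_then_else_; _∧_)
open import Data.Fin using (Fin; zero; suc)
open import Data.Fin.Subset using (Subset; inside; outside; ∣_∣; _⊆_)
open import Data.Fin.Subset.Properties using (_⊆?_; ∣p∣≤n)
open import Data.List using (List; []; _∷_; _++_; map; filter; length; allFin; downFrom; tabulate)
open import Data.List.Membership.Propositional using (_∈_)
open import Data.List.Membership.Propositional.Properties using (∈-++⁺ˡ; ∈-++⁺ʳ; ∈-map⁺)
open import Data.List.Relation.Unary.Any using (here; there)
open import Data.Nat as ℕ using (ℕ; zero; suc; _≤_; s≤s; z≤n)
import Data.Nat.Properties as ℕ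
open import Data.Nat.Combinatorics using (_C_; nCk≡n!/k![n-k]!; k![n∸k]!∣n!; nCk+nC[k+1]≡[n+1]C[k+1])
open import Data.Nat.DivMod using (m≡m%n+[m/n]*n; m%n<n; m/n*n≡m)
open import Data.Nat.Tactic.RingSolver using (solve-∀)
open import Data.Product using (∃-syntax; _×_; _,_; proj₁; proj₂)
open import Data.Sum using (_⊎_; inj₁; inj₂; [_,_]′)
open import Data.Vec using ([]; _∷_; lookup; _[_]≔_) renaming (tabulate to tabulateᵛ)
open import Data.Vec.Properties using ([]≔-lookup; []≔-idempotent; []≔-commutes; lookup∘update′; lookup∘tabulate; []=⇒lookup; lookup⇒[]=)
open import Function using (_∘_; id)
open import Level using (0ℓ)
open import Relation.Binary.PropositionalEquality
open import Relation.Nullary using (yes; no; does; ¬_; contradiction)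
open import Relation.Nullary.Decidable using (⌊_⌋; dec-true; isYes≗does)
open import Relation.Unary using (Pred; Decidable)

-- Since h stays of order h(k) over J sizes, summing over m bounds the probability by the order of k
-- / (mJ) ≈ √(r / m). With m at least of order r ℓ^(1/r) the factor r cancels, so the constant does
-- not depend on r.
--
-- The length J comes from allowing h to lose a fraction 1 / (2J) per step. Let d = k - m be the
-- number of isolated vertices. Over J steps the rate β leaves the critical value m / k by about (m
-- / k)(rJ / d), while the allowance is about d / (Jk); this gives J² ≈ d² / (rm), and ε keeps d of
-- order k. The growth bound on β is one-sided: a small β stays small to the right, and a large β
-- was already large on the left. This is why the side of the window cannot be fixed in advance.
--
-- Probabilities are multiplied by n! and denominators cleared, so the argument runs in ℕ, and
-- ℓ^(1/(2r)) is replaced by an integer z with (8z²)^r < ℓ ≤ (8(z+1)²)^r. The factors 8 (from J ≥ kz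
-- / (8m)), 2 (from halving h) and 2 (from sizes up to 2k) give 32 / z; with √8 ≤ 3 this is 96, and
-- the rest of 100 pays for passing from z to z + 1.

module Counting where

  open import Data.Nat
  open import Data.Nat.Properties

  -- Finite sums

  private
    variable
      A B : Set
      n : ℕ

  ∑ : List A → (A → ℕ) → ℕ
  ∑ []       f = 0
  ∑ (x ∷ xs) f = f x + ∑ xs f

  ∑-cong : ∀ (xs : List A) {f g} → (∀ x → f x ≡ g x) → ∑ xs f ≡ ∑ xs g
  ∑-cong []       h = refl
  ∑-cong (x ∷ xs) h = cong₂ _+_ (h x) (∑-cong xs h)

  ∑-mono : ∀ (xs : List A) {f g} → (∀ x → f x ≤ g x) → ∑ xs f ≤ ∑ xs g
  ∑-mono []       h = z≤n
  ∑-mono (x ∷ xs) h = +-mono-≤ (h x) (∑-mono xs h)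

  ∑-zero : ∀ (xs : List A) → ∑ xs (λ _ → 0) ≡ 0
  ∑-zero []       = refl
  ∑-zero (x ∷ xs) = ∑-zero xs

  ∑-+ : ∀ (xs : List A) f g → ∑ xs (λ x → f x + g x) ≡ ∑ xs f + ∑ xs g
  ∑-+ []       f g = refl
  ∑-+ (x ∷ xs) f g = trans (cong (f x + g x +_) (∑-+ xs f g)) (lem (f x) (g x) (∑ xs f) (∑ xs g))
    where
    lem : ∀ a b c d → a + b + (c + d) ≡ a + c + (b + d)
    lem = solve-∀

  ∑-*ˡ : ∀ c (xs : List A) f → ∑ xs (λ x → c * f x) ≡ c * ∑ xs f
  ∑-*ˡ c []       f = sym (*-zeroʳ c)
  ∑-*ˡ c (x ∷ xs) f = trans (cong (c * f x +_) (∑-*ˡ c xs f)) (sym (*-distribˡ-+ c (f x) (∑ xs f)))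

  ∑-*ʳ : ∀ c (xs : List A) f → ∑ xs (λ x → f x * c) ≡ ∑ xs f * c
  ∑-*ʳ c xs f = trans (∑-cong xs (λ x → *-comm (f x) c)) (trans (∑-*ˡ c xs f) (*-comm c (∑ xs f)))

  ∑-comm : ∀ (xs : List A) (ys : List B) (f : A → B → ℕ) → ∑ xs (λ x → ∑ ys (f x)) ≡ ∑ ys (λ y → ∑ xs (λ x → f x y))
  ∑-comm []       ys f = sym (∑-zero ys)
  ∑-comm (x ∷ xs) ys f = trans (cong (∑ ys (f x) +_) (∑-comm xs ys f)) (sym (∑-+ ys (f x) (λ y → ∑ xs (λ x′ → f x′ y))))

  ∑-++ : ∀ (xs ys : List A) f → ∑ (xs ++ ys) f ≡ ∑ xs f + ∑ ys f
  ∑-++ []       ys f = refl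
  ∑-++ (x ∷ xs) ys f = trans (cong (f x +_) (∑-++ xs ys f)) (sym (+-assoc (f x) _ _))

  ∑-map : ∀ (h : A → B) xs f → ∑ (map h xs) f ≡ ∑ xs (f ∘ h)
  ∑-map h []       f = refl
  ∑-map h (x ∷ xs) f = cong (f (h x) +_) (∑-map h xs f)

  ∑-pos⇒∃ : ∀ (xs : List A) {f} → 0 < ∑ xs f → ∃[ x ] 0 < f x
  ∑-pos⇒∃ (x ∷ xs) {f} p with f x in eq
  ... | suc a = x , subst (0 <_) (sym eq) (s≤s z≤n)
  ... | zero  = ∑-pos⇒∃ xs p

  ∑-term : ∀ (xs : List A) {f x} → x ∈ xs → f x ≤ ∑ xs f
  ∑-term (x ∷ xs) (here refl) = m≤m+n _ _
  ∑-term (x ∷ xs) {f} (there p) = ≤-trans (∑-term xs p) (m≤n+m _ (f x))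

  amgm : ∀ a b → 2 * (a * b) ≤ a * a + b * b
  amgm a b = [ ordered a b , (λ b≤a → subst₂ _≤_ (cong (2 *_) (*-comm b a)) (+-comm (b * b) (a * a)) (ordered b a b≤a)) ]′ (≤-total a b)
    where
    lem : ∀ a c → 2 * (a * (a + c)) + c * c ≡ a * a + (a + c) * (a + c)
    lem = solve-∀
    ordered : ∀ a b → a ≤ b → 2 * (a * b) ≤ a * a + b * b
    ordered a b a≤b = subst (λ b → 2 * (a * b) ≤ a * a + b * b) (m+[n∸m]≡n a≤b)
      (subst (2 * (a * (a + (b ∸ a))) ≤_) (lem a (b ∸ a)) (m≤m+n _ ((b ∸ a) * (b ∸ a))))

  -- Cauchy–Schwarz follows by summing 2ab ≤ a² + b² over all pairs of terms.
  ∑-cauchy : ∀ (xs : List A) (w f : A → ℕ) →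
    ∑ xs (λ x → w x * f x) * ∑ xs (λ x → w x * f x) ≤ ∑ xs w * ∑ xs (λ x → w x * (f x * f x))
  ∑-cauchy xs w f = *-cancelˡ-≤ 2 (begin
    2 * (S * S)
      ≡⟨ cong (2 *_) (sym (trans (∑-cong xs (λ x → ∑-*ˡ (w x * f x) xs wf)) (∑-*ʳ S xs wf))) ⟩
    2 * ∑ xs (λ x → ∑ xs (λ y → w x * f x * (w y * f y)))
      ≡⟨ sym (trans (∑-cong xs (λ x → ∑-*ˡ 2 xs _)) (∑-*ˡ 2 xs _)) ⟩
    ∑ xs (λ x → ∑ xs (λ y → 2 * (w x * f x * (w y * f y))))
      ≤⟨ ∑-mono xs (λ x → ∑-mono xs (λ y → pointwise (w x) (f x) (w y) (f y))) ⟩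
    ∑ xs (λ x → ∑ xs (λ y → w x * wff y + w y * wff x))
      ≡⟨ ∑-cong xs (λ x → trans (∑-+ xs (λ y → w x * wff y) (λ y → w y * wff x))
           (cong₂ _+_ (∑-*ˡ (w x) xs wff) (∑-*ʳ (wff x) xs w))) ⟩
    ∑ xs (λ x → w x * Q + W * wff x)
      ≡⟨ trans (∑-+ xs (λ x → w x * Q) (λ x → W * wff x)) (cong₂ _+_ (∑-*ʳ Q xs w) (∑-*ˡ W xs wff)) ⟩
    W * Q + W * Q
      ≡⟨ cong (W * Q +_) (sym (+-identityʳ _)) ⟩
    2 * (W * Q) ∎)
    where
    open ≤-Reasoning
    wf wff : _ → ℕ
    wf x = w x * f x
    wff x = w x * (f x * f x)
    S = ∑ xs wf
    W = ∑ xs w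
    Q = ∑ xs wff

    pointwise : ∀ u a v b → 2 * (u * a * (v * b)) ≤ u * (v * (b * b)) + v * (u * (a * a))
    pointwise u a v b = subst₂ _≤_ (lem₁ u v a b) (lem₂ u v a b) (*-monoʳ-≤ (u * v) (amgm a b))
      where
      lem₁ : ∀ u v a b → u * v * (2 * (a * b)) ≡ 2 * (u * a * (v * b))
      lem₁ = solve-∀
      lem₂ : ∀ u v a b → u * v * (a * a + b * b) ≡ u * (v * (b * b)) + v * (u * (a * a))
      lem₂ = solve-∀

  ∑-allFin-suc : ∀ (f : Fin (suc n) → ℕ) → ∑ (allFin (suc n)) f ≡ f zero + ∑ (allFin n) (f ∘ suc)
  ∑-allFin-suc f = cong (f zero +_) (shift id)
    where
    shift : ∀ {m} (h : Fin m → Fin _) → ∑ (tabulate (suc ∘ h)) f ≡ ∑ (tabulate h) (f ∘ suc)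
    shift {zero}  h = refl
    shift {suc m} h = cong (f (suc (h zero)) +_) (shift (h ∘ suc))

  -- Indicators

  ind : Bool → ℕ
  ind b = if b then 1 else 0

  eq : ℕ → ℕ → ℕ
  eq a b = ind (a ≡ᵇ b)

  pos : ℕ → ℕ
  pos zero    = 0
  pos (suc _) = 1

  eq-refl : ∀ a → eq a a ≡ 1
  eq-refl zero    = refl
  eq-refl (suc a) = eq-refl a

  eq-≡ : ∀ {a b} → a ≡ b → eq a b ≡ 1
  eq-≡ {a} refl = eq-refl a

  eq-≢ : ∀ {a b} → ¬ a ≡ b → eq a b ≡ 0
  eq-≢ {zero}  {zero}  p = contradiction refl p
  eq-≢ {zero}  {suc b} p = refl
  eq-≢ {suc a} {zero}  p = refl
  eq-≢ {suc a} {suc b} p = eq-≢ {a} {b} (p ∘ cong suc)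

  eq-pos : ∀ a b → 0 < eq a b → a ≡ b
  eq-pos a b p with a ≟ b
  ... | yes q = q
  ... | no ¬q = contradiction (subst (0 <_) (eq-≢ ¬q) p) λ ()

  eq-*-cong : ∀ {a b x y} → (a ≡ b → x ≡ y) → eq a b * x ≡ eq a b * y
  eq-*-cong {a} {b} {x} {y} h with a ≟ b
  ... | yes p = cong (eq a b *_) (h p)
  ... | no ¬p rewrite eq-≢ ¬p = refl

  pos≤1 : ∀ a → pos a ≤ 1
  pos≤1 zero    = z≤n
  pos≤1 (suc a) = s≤s z≤n

  length-filter : ∀ {P : Pred A 0ℓ} (P? : Decidable P) xs → length (filter P? xs) ≡ ∑ xs (λ x → ind (does (P? x)))
  length-filter P? []       = refl
  length-filter P? (x ∷ xs) with does (P? x)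
  ... | true  = cong suc (length-filter P? xs)
  ... | false = length-filter P? xs

  ∑-filter : ∀ {P : Pred A 0ℓ} (P? : Decidable P) xs f → ∑ (filter P? xs) f ≡ ∑ xs (λ x → ind (does (P? x)) * f x)
  ∑-filter P? []       f = refl
  ∑-filter P? (x ∷ xs) f with does (P? x)
  ... | true  = cong₂ _+_ (sym (+-identityʳ (f x))) (∑-filter P? xs f)
  ... | false = ∑-filter P? xs f

  ∑-downFrom-eq : ∀ N a (f : ℕ → ℕ) → a < N → ∑ (downFrom N) (λ m → eq a m * f m) ≡ f a
  ∑-downFrom-eq (suc N) a f (s≤s a≤N) with a ≟ N
  ... | yes refl = trans (cong₂ (λ u v → u * f a + v) (eq-refl a) (vanish a ≤-refl)) (trans (+-identityʳ _) (+-identityʳ _))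
    where
    vanish : ∀ M → M ≤ a → ∑ (downFrom M) (λ m → eq a m * f m) ≡ 0
    vanish zero    _ = refl
    vanish (suc M) p = cong₂ (λ u v → u * f M + v) (eq-≢ (≢-sym (<⇒≢ p))) (vanish M (<⇒≤ p))
  ... | no a≢N = trans (cong (λ u → u * f N + ∑ (downFrom N) (λ m → eq a m * f m)) (eq-≢ a≢N)) (∑-downFrom-eq N a f (≤∧≢⇒< a≤N a≢N))

  ∑-downFrom-mono : ∀ {M N} (f : ℕ → ℕ) → M ≤ N → ∑ (downFrom M) f ≤ ∑ (downFrom N) f
  ∑-downFrom-mono {zero}  {N}     f p = z≤n
  ∑-downFrom-mono {suc M} {suc N} f (s≤s p) with m≤n⇒m<n∨m≡n p
  ... | inj₁ q    = ≤-trans (∑-downFrom-mono f q) (m≤n+m _ (f N))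
  ... | inj₂ refl = ≤-refl

  ∑-downFrom-window : ∀ a J c (f : ℕ → ℕ) → (∀ i → i < J → c ≤ f (a + i)) → J * c ≤ ∑ (downFrom (a + J)) f
  ∑-downFrom-window a zero    c f h = z≤n
  ∑-downFrom-window a (suc J) c f h rewrite +-suc a J =
    +-mono-≤ (h J ≤-refl) (∑-downFrom-window a J c f (λ i p → h i (m<n⇒m<1+n p)))

  -- Sums over subsets

  χ χ̄ : Subset n → Fin n → ℕ
  χ A x = ind (lookup A x)
  χ̄ A x = ind (not (lookup A x))

  infixl 7 _∪′_ _∖′_
  _∪′_ _∖′_ : Subset n → Fin n → Subset n
  A ∪′ x = A [ x ]≔ inside
  A ∖′ x = A [ x ]≔ outside

  ∑-allSubsets-suc : ∀ n (f : Subset (suc n) → ℕ) →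
    ∑ (allSubsets (suc n)) f ≡ ∑ (allSubsets n) (f ∘ (outside ∷_)) + ∑ (allSubsets n) (f ∘ (inside ∷_))
  ∑-allSubsets-suc n f = trans (∑-++ (map (outside ∷_) (allSubsets n)) _ f)
    (cong₂ _+_ (∑-map (outside ∷_) (allSubsets n) f) (∑-map (inside ∷_) (allSubsets n) f))

  ∈-allSubsets : ∀ (s : Subset n) → s ∈ allSubsets n
  ∈-allSubsets []            = here refl
  ∈-allSubsets (outside ∷ s) = ∈-++⁺ˡ (∈-map⁺ (outside ∷_) (∈-allSubsets s))
  ∈-allSubsets {suc n} (inside ∷ s) = ∈-++⁺ʳ (map (outside ∷_) (allSubsets n)) (∈-map⁺ (inside ∷_) (∈-allSubsets s))

  -- Removing `x` is a bijection from the sets that contain `x` to the sets that do not. `F` sees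
  -- both ends, so a weight may depend on either.
  ∑-remove-insert : ∀ (x : Fin n) (F : Subset n → Subset n → ℕ) →
    ∑ (allSubsets n) (λ A → χ A x * F A (A ∖′ x)) ≡ ∑ (allSubsets n) (λ K → χ̄ K x * F (K ∪′ x) K)
  ∑-remove-insert {suc n} zero F =
    trans (∑-allSubsets-suc n _) (trans (trans (cong (_+ inner) (∑-zero (allSubsets n))) (sym
      (trans (cong (inner +_) (∑-zero (allSubsets n))) (+-identityʳ inner)))) (sym (∑-allSubsets-suc n _)))
    where inner = ∑ (allSubsets n) (λ A → 1 * F (inside ∷ A) (outside ∷ A))
  ∑-remove-insert {suc n} (suc x) F =
    trans (∑-allSubsets-suc n _) (trans
      (cong₂ _+_ (∑-remove-insert x (λ A K → F (outside ∷ A) (outside ∷ K)))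
                 (∑-remove-insert x (λ A K → F (inside ∷ A) (inside ∷ K))))
      (sym (∑-allSubsets-suc n _)))

  ∣p∣≡∑χ : ∀ (A : Subset n) → ∣ A ∣ ≡ ∑ (allFin n) (χ A)
  ∣p∣≡∑χ []            = refl
  ∣p∣≡∑χ (outside ∷ A) = trans (∣p∣≡∑χ A) (sym (∑-allFin-suc (χ (outside ∷ A))))
  ∣p∣≡∑χ (inside ∷ A)  = trans (cong suc (∣p∣≡∑χ A)) (sym (∑-allFin-suc (χ (inside ∷ A))))

  ∑χ+∑χ̄ : ∀ (A : Subset n) → ∣ A ∣ + ∑ (allFin n) (χ̄ A) ≡ n
  ∑χ+∑χ̄ []            = refl
  ∑χ+∑χ̄ (outside ∷ A) = trans (cong (∣ A ∣ +_) (∑-allFin-suc (χ̄ (outside ∷ A)))) (trans (+-suc _ _) (cong suc (∑χ+∑χ̄ A)))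
  ∑χ+∑χ̄ (inside ∷ A)  = trans (cong (suc ∣ A ∣ +_) (∑-allFin-suc (χ̄ (inside ∷ A)))) (cong suc (∑χ+∑χ̄ A))

  ∣∪′∣ : ∀ (A : Subset n) x → lookup A x ≡ false → ∣ A ∪′ x ∣ ≡ suc ∣ A ∣
  ∣∪′∣ (outside ∷ A) zero    p = refl
  ∣∪′∣ (outside ∷ A) (suc x) p = ∣∪′∣ A x p
  ∣∪′∣ (inside ∷ A)  (suc x) p = cong suc (∣∪′∣ A x p)

  ∑-size : ∀ n t → ∑ (allSubsets n) (λ A → eq ∣ A ∣ t) ≡ n C t
  ∑-size zero    zero    = refl
  ∑-size zero    (suc t) = refl
  ∑-size (suc n) zero    = trans (∑-allSubsets-suc n _) (trans (cong₂ _+_ (∑-size n zero) (∑-zero (allSubsets n))) refl)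
  ∑-size (suc n) (suc t) = trans (∑-allSubsets-suc n _)
    (trans (cong₂ _+_ (∑-size n (suc t)) (∑-size n t)) (trans (+-comm (n C suc t) (n C t)) (nCk+nC[k+1]≡[n+1]C[k+1] n t)))

  -- Families of sets

  -- Only an inequality because `x ∈ K` is not excluded; nothing is lost for `x ∉ K`. The term `f x`
  -- becomes the diagonal in the count of pairs of extensions.
  χ̄-split : ∀ (K : Subset n) x (f : Fin n → ℕ) →
    ∑ (allFin n) (λ y → χ̄ K y * f y) ≤ f x + ∑ (allFin n) (λ y → χ̄ (K ∪′ x) y * f y)
  χ̄-split {suc n} (b ∷ K) zero f = subst₂ _≤_
    (sym (∑-allFin-suc (λ y → χ̄ (b ∷ K) y * f y)))
    (cong (f zero +_) (sym (∑-allFin-suc (λ y → χ̄ (inside ∷ K) y * f y))))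
    (+-monoˡ-≤ _ (head b))
    where
    head : ∀ b → ind (not b) * f zero ≤ f zero
    head true  = z≤n
    head false = ≤-reflexive (+-identityʳ _)
  χ̄-split {suc n} (b ∷ K) (suc x) f = subst₂ _≤_
    (sym (∑-allFin-suc (λ y → χ̄ (b ∷ K) y * f y)))
    (trans (swap (ind (not b) * f zero) (f (suc x)) _)
           (cong (f (suc x) +_) (sym (∑-allFin-suc (λ y → χ̄ (b ∷ (K ∪′ x)) y * f y)))))
    (+-monoʳ-≤ (ind (not b) * f zero) (χ̄-split K x (f ∘ suc)))
    where
    swap : ∀ a b c → a + (b + c) ≡ b + (a + c)
    swap = solve-∀

  -- The double counting behind the comparison of consecutive sizes: a pair (K , x) with x outside K
  -- is the same as a pair (A , x) with x in A.
  ∑-transfer : ∀ (F : Subset n → Subset n → ℕ) →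
    ∑ (allSubsets n) (λ K → ∑ (allFin n) (λ x → χ̄ K x * F (K ∪′ x) K)) ≡
    ∑ (allSubsets n) (λ A → ∑ (allFin n) (λ x → χ A x * F A (A ∖′ x)))
  ∑-transfer {n} F = trans (∑-comm (allSubsets n) (allFin n) (λ K x → χ̄ K x * F (K ∪′ x) K))
    (trans (∑-cong (allFin n) (λ x → sym (∑-remove-insert x F)))
           (∑-comm (allFin n) (allSubsets n) (λ x A → χ A x * F A (A ∖′ x))))

  χ̄-*-cong : ∀ (K : Subset n) x {a b} → (lookup K x ≡ false → a ≡ b) → χ̄ K x * a ≡ χ̄ K x * b
  χ̄-*-cong K x h with lookup K x
  ... | true  = refl
  ... | false = cong (1 *_) (h refl)

  χ̄-*-mono : ∀ (K : Subset n) x {a b} → (lookup K x ≡ false → a ≤ b) → χ̄ K x * a ≤ χ̄ K x * b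
  χ̄-*-mono K x h with lookup K x
  ... | true  = z≤n
  ... | false = *-monoʳ-≤ 1 (h refl)

  -- For a {0,1}-valued φ, `members t` counts the sets of size t in the family, and `extensions t`
  -- and `blockings t` count the pairs (K , x) of a member K of size t and x ∉ K for which K ∪ {x}
  -- does, respectively does not, belong to the family.
  module Family {n : ℕ} (φ : Subset n → ℕ) (m r : ℕ)
    (φ01 : ∀ A → φ A ≡ 0 ⊎ φ A ≡ 1)
    (removable : ∀ A → φ A ≡ 1 → ∑ (allFin n) (λ x → χ A x * φ (A ∖′ x)) + m ≡ ∣ A ∣)
    (fewUnblockers : ∀ D y → φ D ≡ 1 → lookup D y ≡ false → φ (D ∪′ y) ≡ 0 →
      ∑ (allFin n) (λ x → χ D x * (φ (D ∖′ x) * φ (D ∖′ x ∪′ y))) ≤ r)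
    where

    Σs : (Subset n → ℕ) → ℕ
    Σs = ∑ (allSubsets n)

    Σx : (Fin n → ℕ) → ℕ
    Σx = ∑ (allFin n)

    w : ℕ → Subset n → ℕ
    w t A = eq ∣ A ∣ t * φ A

    ext blk rem : Subset n → ℕ
    ext K = Σx (λ x → χ̄ K x * φ (K ∪′ x))
    blk K = Σx (λ x → χ̄ K x * (1 ∸ φ (K ∪′ x)))
    rem A = Σx (λ x → χ A x * φ (A ∖′ x))

    members extensions blockings : ℕ → ℕ
    members t    = Σs (w t)
    extensions t = Σs (λ K → w t K * ext K)
    blockings t  = Σs (λ K → w t K * blk K)

    w-cong : ∀ t A {a b} → (∣ A ∣ ≡ t → φ A ≡ 1 → a ≡ b) → w t A * a ≡ w t A * b
    w-cong t A {a} {b} h = trans (*-assoc (eq ∣ A ∣ t) (φ A) a)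
      (trans (eq-*-cong (λ p → inner p (φ01 A))) (sym (*-assoc (eq ∣ A ∣ t) (φ A) b)))
      where
      inner : ∣ A ∣ ≡ t → φ A ≡ 0 ⊎ φ A ≡ 1 → φ A * a ≡ φ A * b
      inner p (inj₁ q) rewrite q = refl
      inner p (inj₂ q) = cong (φ A *_) (h p q)

    w-mono : ∀ t A {a b} → (∣ A ∣ ≡ t → φ A ≡ 1 → a ≤ b) → w t A * a ≤ w t A * b
    w-mono t A {a} {b} h with ∣ A ∣ ≟ t | φ01 A
    ... | yes p | inj₂ q = *-monoʳ-≤ (w t A) (h p q)
    ... | yes p | inj₁ q rewrite q | *-zeroʳ (eq ∣ A ∣ t) = z≤n
    ... | no ¬p | _ rewrite eq-≢ ¬p = z≤n

    φ≤1 : ∀ A → φ A ≤ 1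
    φ≤1 A with φ01 A
    ... | inj₁ q rewrite q = z≤n
    ... | inj₂ q rewrite q = ≤-refl

    ext+blk : ∀ K → ∣ K ∣ + (ext K + blk K) ≡ n
    ext+blk K = trans (cong (∣ K ∣ +_) (trans (sym (∑-+ (allFin n) _ _)) (∑-cong (allFin n) pointwise))) (∑χ+∑χ̄ K)
      where
      pointwise : ∀ x → χ̄ K x * φ (K ∪′ x) + χ̄ K x * (1 ∸ φ (K ∪′ x)) ≡ χ̄ K x
      pointwise x = trans (sym (*-distribˡ-+ (χ̄ K x) _ _))
        (trans (cong (χ̄ K x *_) (m+[n∸m]≡n (φ≤1 (K ∪′ x)))) (*-identityʳ _))

    extensions+blockings : ∀ t u → t + u ≡ n → extensions t + blockings t ≡ u * members t
    extensions+blockings t u t+u≡n = begin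
      extensions t + blockings t
        ≡⟨ sym (∑-+ (allSubsets n) _ _) ⟩
      Σs (λ K → w t K * ext K + w t K * blk K)
        ≡⟨ ∑-cong (allSubsets n) (λ K → trans (sym (*-distribˡ-+ (w t K) (ext K) (blk K)))
             (w-cong t K (λ p _ → +-cancelˡ-≡ t _ _ (trans (cong (_+ _) (sym p)) (trans (ext+blk K) (sym t+u≡n)))))) ⟩
      Σs (λ K → w t K * u)
        ≡⟨ ∑-*ʳ u (allSubsets n) (w t) ⟩
      members t * u
        ≡⟨ *-comm (members t) u ⟩
      u * members t ∎
      where open ≡-Reasoning

    -- Nested members of sizes `t` and `suc t` are counted from the larger one: by `removable` it
    -- has exactly `t′` vertices whose removal leaves a member.
    extensions≡ : ∀ t t′ → t′ + m ≡ suc t → extensions t ≡ t′ * members (suc t)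
    extensions≡ t t′ t′+m≡ = begin
      extensions t
        ≡⟨ ∑-cong (allSubsets n) (λ K → trans (sym (∑-*ˡ (w t K) (allFin n) _)) (∑-cong (allFin n) (before K))) ⟩
      Σs (λ K → Σx (λ x → χ̄ K x * F (K ∪′ x) K))
        ≡⟨ ∑-transfer F ⟩
      Σs (λ A → Σx (λ x → χ A x * F A (A ∖′ x)))
        ≡⟨ ∑-cong (allSubsets n) (λ A → trans (∑-cong (allFin n) (λ x → after (χ A x) (w (suc t) A) (φ (A ∖′ x))))
             (trans (∑-*ˡ (w (suc t) A) (allFin n) _)
               (w-cong (suc t) A (λ p q → +-cancelʳ-≡ m _ _ (trans (removable A q) (trans p (sym t′+m≡))))))) ⟩
      Σs (λ A → w (suc t) A * t′)
        ≡⟨ ∑-*ʳ t′ (allSubsets n) (w (suc t)) ⟩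
      members (suc t) * t′
        ≡⟨ *-comm (members (suc t)) t′ ⟩
      t′ * members (suc t) ∎
      where
      open ≡-Reasoning
      F : Subset n → Subset n → ℕ
      F A K = w (suc t) A * φ K
      after : ∀ a b c → a * (b * c) ≡ b * (a * c)
      after = solve-∀
      shuffle : ∀ e k c p → e * k * (c * p) ≡ c * (e * p * k)
      shuffle = solve-∀
      before : ∀ K x → w t K * (χ̄ K x * φ (K ∪′ x)) ≡ χ̄ K x * F (K ∪′ x) K
      before K x = trans (shuffle (eq ∣ K ∣ t) (φ K) (χ̄ K x) (φ (K ∪′ x)))
        (χ̄-*-cong K x (λ q → cong (λ s → eq s (suc t) * φ (K ∪′ x) * φ K) (sym (∣∪′∣ K x q))))

    -- The triples (K , x , y) with K, K ∪ {x} and K ∪ {y} members are grouped by D = K ∪ {x}. Those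
    -- with y = x give the first term. For y outside D there are at most `t′` choices of x if D ∪
    -- {y} is a member, and at most `r` if y is blocked.
    ext²≤ : ∀ t t′ → t′ + m ≡ suc t → Σs (λ K → w t K * (ext K * ext K)) ≤
      t′ * members (suc t) + (t′ * extensions (suc t) + r * blockings (suc t))
    ext²≤ t t′ t′+m≡ = begin
      Σs (λ K → w t K * (ext K * ext K))
        ≤⟨ ∑-mono (allSubsets n) (λ K → ≤-trans (≤-reflexive (expand K)) (∑-mono (allFin n) (before K))) ⟩
      Σs (λ K → Σx (λ x → χ̄ K x * F (K ∪′ x) K))
        ≡⟨ ∑-transfer F ⟩
      Σs (λ A → Σx (λ x → χ A x * F A (A ∖′ x)))
        ≡⟨ ∑-cong (allSubsets n) after ⟩
      Σs (λ D → w (suc t) D * (rem D + Σx (λ y → χ̄ D y * Σx (λ x → χ D x * (φ (D ∖′ x) * φ (D ∖′ x ∪′ y))))))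
        ≤⟨ ∑-mono (allSubsets n) (λ D → w-mono (suc t) D (bound D)) ⟩
      Σs (λ D → w (suc t) D * (t′ + (t′ * ext D + r * blk D)))
        ≡⟨ ∑-cong (allSubsets n) (λ D → distribute (w (suc t) D) t′ (ext D) r (blk D)) ⟩
      Σs (λ D → t′ * w (suc t) D + (t′ * (w (suc t) D * ext D) + r * (w (suc t) D * blk D)))
        ≡⟨ trans (∑-+ (allSubsets n) _ _) (cong₂ _+_ (∑-*ˡ t′ (allSubsets n) _)
             (trans (∑-+ (allSubsets n) _ _) (cong₂ _+_ (∑-*ˡ t′ (allSubsets n) _) (∑-*ˡ r (allSubsets n) _)))) ⟩
      t′ * members (suc t) + (t′ * extensions (suc t) + r * blockings (suc t)) ∎
      where
      open ≤-Reasoning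
      F : Subset n → Subset n → ℕ
      F A K = w (suc t) A * (φ K * (1 + Σx (λ y → χ̄ A y * φ (K ∪′ y))))
      distribute : ∀ a t e r b → a * (t + (t * e + r * b)) ≡ t * a + (t * (a * e) + r * (a * b))
      distribute = solve-∀
      expand : ∀ K → w t K * (ext K * ext K) ≡ Σx (λ x → χ̄ K x * (w t K * (φ (K ∪′ x) * ext K)))
      expand K = trans (lem₁ (w t K) (ext K)) (trans (sym (∑-*ʳ (w t K * ext K) (allFin n) _))
        (∑-cong (allFin n) (λ x → lem₂ (χ̄ K x) (φ (K ∪′ x)) (w t K) (ext K))))
        where
        lem₁ : ∀ a e → a * (e * e) ≡ e * (a * e)
        lem₁ = solve-∀
        lem₂ : ∀ c p a e → c * p * (a * e) ≡ c * (a * (p * e))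
        lem₂ = solve-∀
      before : ∀ K x → χ̄ K x * (w t K * (φ (K ∪′ x) * ext K)) ≤ χ̄ K x * F (K ∪′ x) K
      before K x = χ̄-*-mono K x λ q → subst₂ _≤_ refl
        (trans (lem (eq ∣ K ∣ t) (φ K) (φ (K ∪′ x)) _)
          (cong (λ s → eq s (suc t) * φ (K ∪′ x) * (φ K * (1 + Σx (λ y → χ̄ (K ∪′ x) y * φ (K ∪′ y))))) (sym (∣∪′∣ K x q))))
        (*-monoʳ-≤ (w t K) (*-monoʳ-≤ (φ (K ∪′ x))
          (≤-trans (χ̄-split K x (λ y → φ (K ∪′ y))) (+-monoˡ-≤ _ (φ≤1 (K ∪′ x))))))
        where
        lem : ∀ e k p s → e * k * (p * s) ≡ e * p * (k * s)
        lem = solve-∀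
      after : ∀ A → Σx (λ x → χ A x * F A (A ∖′ x)) ≡
        w (suc t) A * (rem A + Σx (λ y → χ̄ A y * Σx (λ x → χ A x * (φ (A ∖′ x) * φ (A ∖′ x ∪′ y)))))
      after A = trans (∑-cong (allFin n) (λ x → lem₁ (χ A x) (w (suc t) A) (φ (A ∖′ x)) _))
        (trans (∑-*ˡ (w (suc t) A) (allFin n) _) (cong (w (suc t) A *_)
          (trans (∑-+ (allFin n) _ _) (cong (rem A +_)
            (trans (∑-cong (allFin n) (λ x → trans (sym (∑-*ˡ (χ A x * φ (A ∖′ x)) (allFin n) _))
                (∑-cong (allFin n) (λ y → lem₂ (χ A x) (φ (A ∖′ x)) (χ̄ A y) (φ (A ∖′ x ∪′ y))))))
              (trans (∑-comm (allFin n) (allFin n) _) (∑-cong (allFin n) (λ y → ∑-*ˡ (χ̄ A y) (allFin n) _))))))))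
        where
        lem₁ : ∀ c a p s → c * (a * (p * (1 + s))) ≡ a * (c * p + c * p * s)
        lem₁ = solve-∀
        lem₂ : ∀ c p d q → c * p * (d * q) ≡ d * (c * (p * q))
        lem₂ = solve-∀
      bound : ∀ D → ∣ D ∣ ≡ suc t → φ D ≡ 1 →
        rem D + Σx (λ y → χ̄ D y * Σx (λ x → χ D x * (φ (D ∖′ x) * φ (D ∖′ x ∪′ y)))) ≤ t′ + (t′ * ext D + r * blk D)
      bound D p q = +-mono-≤ (≤-reflexive rem≡) (≤-trans (∑-mono (allFin n) (λ y → χ̄-*-mono D y (each y (φ01 (D ∪′ y)))))
        (≤-reflexive (trans (∑-cong (allFin n) (λ y → lem (χ̄ D y) (φ (D ∪′ y)) t′ r (1 ∸ φ (D ∪′ y))))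
          (trans (∑-+ (allFin n) _ _) (cong₂ _+_ (∑-*ˡ t′ (allFin n) _) (∑-*ˡ r (allFin n) _))))))
        where
        rem≡ : rem D ≡ t′
        rem≡ = +-cancelʳ-≡ m _ _ (trans (removable D q) (trans p (sym t′+m≡)))
        lem : ∀ c p t r u → c * (t * p + r * u) ≡ t * (c * p) + r * (c * u)
        lem = solve-∀
        each : ∀ y → φ (D ∪′ y) ≡ 0 ⊎ φ (D ∪′ y) ≡ 1 → lookup D y ≡ false →
          Σx (λ x → χ D x * (φ (D ∖′ x) * φ (D ∖′ x ∪′ y))) ≤ t′ * φ (D ∪′ y) + r * (1 ∸ φ (D ∪′ y))
        each y (inj₁ z) y∉D rewrite z | *-zeroʳ t′ | *-identityʳ r = fewUnblockers D y q y∉D z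
        each y (inj₂ o) y∉D rewrite o | *-zeroʳ r | *-identityʳ t′ | +-identityʳ t′ =
          ≤-trans (∑-mono (allFin n) (λ x → *-monoʳ-≤ (χ D x)
            (≤-trans (*-monoʳ-≤ (φ (D ∖′ x)) (φ≤1 (D ∖′ x ∪′ y))) (≤-reflexive (*-identityʳ _))))) (≤-reflexive rem≡)

    -- The average number of blocked vertices grows by a factor of at most t′ / (t′ - r) per step.
    -- Cauchy–Schwarz compares the pairs (K ∪ {x} , K ∪ {y}) of members with the members K.
    blockings-growth : ∀ t t′ u → t′ + m ≡ suc t → suc t + u ≡ n →
      t′ * (blockings (suc t) * members t) ≤ t′ * (blockings t * members (suc t)) + r * (blockings (suc t) * members t)
    -- `P` is `extensions t`, so Cauchy-Schwarz bounds `P * P`, which is added to both sides and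
    -- cancelled. The diagonal term `g₀ * P` turns the `u` vertices outside D into the `suc u`
    -- outside K, leaving only the term with `r` as an error.
    blockings-growth t t′ u t′+m≡ t+u≡ = +-cancelʳ-≤ (P * P) _ _ (begin
      t′ * (b₁ * g₀) + P * P
        ≤⟨ +-monoʳ-≤ (t′ * (b₁ * g₀)) cs ⟩
      t′ * (b₁ * g₀) + g₀ * (P + (t′ * p₁ + r * b₁))
        ≡⟨ lem₁ t′ b₁ g₀ P p₁ r ⟩
      g₀ * P + g₀ * (t′ * (p₁ + b₁)) + r * (b₁ * g₀)
        ≡⟨ cong (λ s → g₀ * P + g₀ * (t′ * s) + r * (b₁ * g₀)) (extensions+blockings (suc t) u t+u≡) ⟩
      g₀ * P + g₀ * (t′ * (u * g₁)) + r * (b₁ * g₀)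
        ≡⟨ lem₂ t′ b₁ g₀ g₁ u r ⟩
      P * (suc u * g₀) + r * (b₁ * g₀)
        ≡⟨ cong (λ s → P * s + r * (b₁ * g₀)) (sym total) ⟩
      P * (P + b₀) + r * (b₁ * g₀)
        ≡⟨ lem₃ t′ b₀ g₁ (r * (b₁ * g₀)) ⟩
      t′ * (b₀ * g₁) + r * (b₁ * g₀) + P * P ∎)
      where
      open ≤-Reasoning
      g₀ = members t
      g₁ = members (suc t)
      b₀ = blockings t
      b₁ = blockings (suc t)
      p₁ = extensions (suc t)
      P = t′ * g₁
      cs : P * P ≤ g₀ * (P + (t′ * p₁ + r * b₁))
      cs = ≤-trans (≤-reflexive (cong₂ _*_ (sym (extensions≡ t t′ t′+m≡)) (sym (extensions≡ t t′ t′+m≡))))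
        (≤-trans (∑-cauchy (allSubsets n) (w t) ext) (*-monoʳ-≤ g₀ (ext²≤ t t′ t′+m≡)))
      total : P + b₀ ≡ suc u * g₀
      total = trans (cong (_+ b₀) (sym (extensions≡ t t′ t′+m≡))) (extensions+blockings t (suc u) (trans (+-suc t u) t+u≡))
      lem₁ : ∀ t b g P p r → t * (b * g) + g * (P + (t * p + r * b)) ≡ g * P + g * (t * (p + b)) + r * (b * g)
      lem₁ = solve-∀
      lem₂ : ∀ t b g g′ u r → g * (t * g′) + g * (t * (u * g′)) + r * (b * g) ≡ t * g′ * (suc u * g) + r * (b * g)
      lem₂ = solve-∀
      lem₃ : ∀ t b g c → t * g * (t * g + b) + c ≡ t * (b * g) + c + t * g * (t * g)
      lem₃ = solve-∀

  -- Slowly varying sequences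

  -- Each step keeps a fraction 1 - 1 / (2J), so Bernoulli's inequality, here `linear`, keeps 1 - j
  -- / (2J) after j steps; this is at least 1/2 up to j = J.
  slow-decay : ∀ c J (f : ℕ → ℕ) → suc c ≡ 2 * J → (∀ j → j < J → c * f j ≤ suc c * f (suc j)) →
    ∀ j → j ≤ J → f 0 ≤ 2 * f j
  slow-decay c zero    f () h
  slow-decay c J@(suc _) f c+1≡2J h j j≤J = *-cancelˡ-≤ J (+-cancelʳ-≤ (J * f 0) _ _ (begin
    J * f 0 + J * f 0        ≡⟨ lem₁ J (f 0) ⟩
    2 * J * f 0              ≡⟨ cong (_* f 0) (sym c+1≡2J) ⟩
    suc c * f 0              ≤⟨ linear j j≤J ⟩
    suc c * f j + j * f 0    ≡⟨ cong (λ s → s * f j + j * f 0) c+1≡2J ⟩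
    2 * J * f j + j * f 0    ≤⟨ +-mono-≤ (≤-reflexive (lem₂ J (f j))) (*-monoˡ-≤ (f 0) j≤J) ⟩
    J * (2 * f j) + J * f 0  ∎))
    where
    open ≤-Reasoning
    lem₁ : ∀ J x → J * x + J * x ≡ 2 * J * x
    lem₁ = solve-∀
    lem₂ : ∀ J x → 2 * J * x ≡ J * (2 * x)
    lem₂ = solve-∀
    linear : ∀ j → j ≤ J → suc c * f 0 ≤ suc c * f j + j * f 0
    linear zero    _   = m≤m+n _ _
    linear (suc j) j<J = begin
      suc c * f 0                                ≡⟨ +-comm (f 0) (c * f 0) ⟩
      c * f 0 + f 0                              ≤⟨ +-monoˡ-≤ (f 0) (*-cancelˡ-≤ (suc c) step) ⟩
      suc c * f (suc j) + j * f 0 + f 0          ≡⟨ lem₃ (suc c * f (suc j)) j (f 0) ⟩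
      suc c * f (suc j) + suc j * f 0            ∎
      where
      lem₃ : ∀ a j x → a + j * x + x ≡ a + suc j * x
      lem₃ = solve-∀
      lem₄ : ∀ c x → suc c * (c * x) ≡ c * (suc c * x)
      lem₄ = solve-∀
      lem₅ : ∀ c s x y → c * (s * x + y) ≡ s * (c * x) + c * y
      lem₅ = solve-∀
      step : suc c * (c * f 0) ≤ suc c * (suc c * f (suc j) + j * f 0)
      step = begin
        suc c * (c * f 0)                                 ≡⟨ lem₄ c (f 0) ⟩
        c * (suc c * f 0)                                 ≤⟨ *-monoʳ-≤ c (linear j (<⇒≤ j<J)) ⟩
        c * (suc c * f j + j * f 0)                       ≡⟨ lem₅ c (suc c) (f j) (j * f 0) ⟩
        suc c * (c * f j) + c * (j * f 0)                 ≤⟨ +-mono-≤ (*-monoʳ-≤ (suc c) (h j j<J)) (*-monoˡ-≤ (j * f 0) (n≤1+n c)) ⟩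
        suc c * (suc c * f (suc j)) + suc c * (j * f 0)   ≡⟨ sym (*-distribˡ-+ (suc c) (suc c * f (suc j)) (j * f 0)) ⟩
        suc c * (suc c * f (suc j) + j * f 0)             ∎

  -- β D / H D plays the role of a hazard rate: by `balance` it governs H (suc D) / H D, and by
  -- `growth` it increases slowly.  So H falls slowly to the right of d if the rate just before d
  -- is at most the critical value m / (m + d), and slowly to the left otherwise.
  module Window (H β : ℕ → ℕ) (m R N : ℕ)
    (balance : ∀ D → m + D < N → suc (m + D) * H D ≡ suc D * H (suc D) + suc (m + D) * β D)
    (growth : ∀ D → m + suc D < N →
      suc D * (β (suc D) * H D) ≤ suc D * (β D * H (suc D)) + R * (β (suc D) * H D))
    where

    -- The factor 1 - R / (D + 1) is weakened to 1 - R / e, so that one `e` serves all steps of a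
    -- window. Truncated subtraction leaves nothing to claim for e ≤ R.
    growth-from : ∀ e D → e ≤ suc D → m + suc D < N → (e ∸ R) * (β (suc D) * H D) ≤ e * (β D * H (suc D))
    growth-from e D e≤ D<N with ≤-total (β (suc D) * H D) (β D * H (suc D))
    ... | inj₁ x≤y = *-mono-≤ (m∸n≤m e R) x≤y
    ... | inj₂ y≤x = begin
      (e ∸ R) * x        ≡⟨ *-distribʳ-∸ x e R ⟩
      e * x ∸ R * x      ≤⟨ m≤n+o⇒m∸n≤o (e * x) (R * x) (begin
        e * x              ≡⟨ cong (e *_) (sym (m+[n∸m]≡n y≤x)) ⟩
        e * (y + z)        ≡⟨ *-distribˡ-+ e y z ⟩
        e * y + e * z      ≤⟨ +-monoʳ-≤ (e * y) (≤-trans (*-monoˡ-≤ z e≤) Sz≤Rx) ⟩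
        e * y + R * x      ≡⟨ +-comm (e * y) (R * x) ⟩
        R * x + e * y      ∎) ⟩
      e * y              ∎
      where
      open ≤-Reasoning
      x = β (suc D) * H D
      y = β D * H (suc D)
      z = x ∸ y
      Sz≤Rx : suc D * z ≤ R * x
      Sz≤Rx = +-cancelˡ-≤ (suc D * y) _ _ (subst (_≤ suc D * y + R * x)
        (trans (cong (suc D *_) (sym (m+[n∸m]≡n y≤x))) (*-distribˡ-+ (suc D) y z)) (growth D D<N))

    β-vanishes : ∀ D → m + D < N → H D ≡ 0 → β D ≡ 0
    β-vanishes D D<N H≡0 = m+n≡0⇒m≡0 (β D) (m+n≡0⇒n≡0 (suc D * H (suc D))
      (trans (sym (balance D D<N)) (trans (cong (suc (m + D) *_) H≡0) (*-zeroʳ (suc (m + D))))))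

    H-vanishes : ∀ D → m + D < N → H D ≡ 0 → H (suc D) ≡ 0
    H-vanishes D D<N H≡0 = m+n≡0⇒m≡0 (H (suc D)) (m+n≡0⇒m≡0 (suc D * H (suc D))
      (trans (sym (balance D D<N)) (trans (cong (suc (m + D) *_) H≡0) (*-zeroʳ (suc (m + D))))))

    -- The product of `i` one-step factors is (1 - R / e)^i, which `shrink` keeps above 1 - iR / e.
    growth-iterated : ∀ e D i → 0 < e → e ≤ suc D → m + (D + i) < N →
      β (D + i) * H D * (e ∸ i * R) ≤ e * (β D * H (D + i))
    growth-iterated e D zero 0<e e≤ D<N rewrite +-identityʳ D = ≤-reflexive (*-comm (β D * H D) e)
    growth-iterated e D (suc i) 0<e e≤ D+i<N rewrite +-suc D i with H (D + i) in eqH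
    -- The induction step divides by `H (D + i)`. If that is zero, `H` and `β` vanish one step
    -- later, and so does the left side.
    ... | zero = subst (λ b → b * H D * (e ∸ (R + i * R)) ≤ e * (β D * H (suc (D + i))))
        (sym (β-vanishes (suc (D + i)) D+i<N (H-vanishes (D + i) D+i<N′ eqH))) z≤n
      where D+i<N′ = ≤-<-trans (+-monoʳ-≤ m (n≤1+n (D + i))) D+i<N
    ... | suc h = *-cancelˡ-≤ e {{>-nonZero 0<e}} (*-cancelˡ-≤ (suc h) (begin
      suc h * (e * (β⁺ * H D * (e ∸ (R + i * R))))
        ≡⟨ lem₁ (suc h) e β⁺ (H D) (e ∸ (R + i * R)) ⟩
      suc h * β⁺ * H D * ((e ∸ (R + i * R)) * e)
        ≤⟨ *-monoʳ-≤ (suc h * β⁺ * H D) (shrink (i * R)) ⟩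
      suc h * β⁺ * H D * ((e ∸ i * R) * (e ∸ R))
        ≡⟨ lem₂ (suc h) β⁺ (H D) (e ∸ i * R) (e ∸ R) ⟩
      (e ∸ R) * (β⁺ * suc h) * (H D * (e ∸ i * R))
        ≤⟨ *-monoˡ-≤ (H D * (e ∸ i * R)) (subst (λ s → (e ∸ R) * (β⁺ * s) ≤ e * (βᵢ * H⁺)) eqH
             (growth-from e (D + i) (≤-trans e≤ (s≤s (m≤m+n D i))) D+i<N)) ⟩
      e * (βᵢ * H⁺) * (H D * (e ∸ i * R))
        ≡⟨ lem₃ e βᵢ H⁺ (H D) (e ∸ i * R) ⟩
      e * H⁺ * (βᵢ * H D * (e ∸ i * R))
        ≤⟨ *-monoʳ-≤ (e * H⁺) (subst (λ s → βᵢ * H D * (e ∸ i * R) ≤ e * (β D * s)) eqH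
             (growth-iterated e D i 0<e e≤ (≤-<-trans (+-monoʳ-≤ m (n≤1+n (D + i))) D+i<N))) ⟩
      e * H⁺ * (e * (β D * suc h))
        ≡⟨ lem₄ e H⁺ (β D) (suc h) ⟩
      suc h * (e * (e * (β D * H⁺))) ∎))
      where
      open ≤-Reasoning
      β⁺ = β (suc (D + i))
      βᵢ = β (D + i)
      H⁺ = H (suc (D + i))
      lem₁ : ∀ h e b g x → h * (e * (b * g * x)) ≡ h * b * g * (x * e)
      lem₁ = solve-∀
      lem₂ : ∀ h b g x y → h * b * g * (x * y) ≡ y * (b * h) * (g * x)
      lem₂ = solve-∀
      lem₃ : ∀ e b h g x → e * (b * h) * (g * x) ≡ e * h * (b * g * x)
      lem₃ = solve-∀
      lem₄ : ∀ e h b g → e * h * (e * (b * g)) ≡ g * (e * (e * (b * h)))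
      lem₄ = solve-∀
      shrink : ∀ s → (e ∸ (R + s)) * e ≤ (e ∸ s) * (e ∸ R)
      shrink s with ≤-total e (R + s)
      ... | inj₁ e≤ rewrite m≤n⇒m∸n≡0 e≤ = z≤n
      ... | inj₂ ≤e = subst (λ e → (e ∸ (R + s)) * e ≤ (e ∸ s) * (e ∸ R)) (m+[n∸m]≡n ≤e) (explicit (e ∸ (R + s)))
        where
        lem₅ : ∀ R s x → (R + x) * (s + x) ≡ x * (R + s + x) + R * s
        lem₅ = solve-∀
        lem₆ : ∀ R s x → R + s + x ≡ s + (R + x)
        lem₆ = solve-∀
        explicit : ∀ x → (R + s + x ∸ (R + s)) * (R + s + x) ≤ (R + s + x ∸ s) * (R + s + x ∸ R)
        explicit x = begin
          (R + s + x ∸ (R + s)) * (R + s + x)       ≡⟨ cong (_* (R + s + x)) (m+n∸m≡n (R + s) x) ⟩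
          x * (R + s + x)                           ≤⟨ m≤m+n _ (R * s) ⟩
          x * (R + s + x) + R * s                   ≡⟨ sym (lem₅ R s x) ⟩
          (R + x) * (s + x)                         ≡⟨ sym (cong₂ _*_
            (trans (cong (_∸ s) (lem₆ R s x)) (m+n∸m≡n s (R + x)))
            (trans (cong (_∸ R) (+-assoc R s x)) (m+n∸m≡n R (s + x)))) ⟩
          (R + s + x ∸ s) * (R + s + x ∸ R)         ∎

    -- The rate is tested at `d₀`, the last step before size `k`. `J-small` is the bound J = O(d /
    -- √(mR)); the next two conditions keep d - J and d - JR at least d / 2.
    module _ (d₀ J c : ℕ)
      (c+1≡2J : suc c ≡ 2 * J)
      (J-small : 8 * (J * J * m * suc R) ≤ suc d₀ * suc d₀)
      (2J≤d : 2 * J ≤ suc d₀) (2JR≤d : 2 * (J * R) ≤ suc d₀) (k+J<N : m + suc d₀ + J < N)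
      (0<H : 0 < H d₀)
      where

      open ≤-Reasoning

      d k : ℕ
      d = suc d₀
      k = m + d

      instance
        H-nonZero : NonZero (H d₀)
        H-nonZero = >-nonZero 0<H

        k-nonZero : NonZero k
        k-nonZero = >-nonZero (≤-trans (s≤s z≤n) (m≤n+m d m))

      -- By `balance` this amounts to T β / H ≤ m + (D + 1) / (2J). Compared with the subcritical
      -- rate at `d₀`, the rate at `D` has grown by a factor of at most d / (d - JR), and T exceeds
      -- `k` by at most `J`; the term (D + 1) / (2J) pays for both.
      up-step : k * β d₀ ≤ m * H d₀ → ∀ j → j < J → c * H (d + j) ≤ suc c * H (suc (d + j))
      up-step rate≤ j j<J = *-cancelˡ-≤ (suc D) (+-cancelʳ-≤ (suc c * (T * β D)) _ _ (begin
        suc D * (c * H D) + suc c * (T * β D)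
          ≤⟨ +-monoʳ-≤ (suc D * (c * H D)) main ⟩
        suc D * (c * H D) + (suc c * (m * H D) + suc D * H D)
          ≡⟨ lem₁ D c (H D) m ⟩
        suc c * (T * H D)
          ≡⟨ cong (suc c *_) (balance D D<N) ⟩
        suc c * (suc D * H (suc D) + T * β D)
          ≡⟨ lem₂ (suc c) (suc D) (H (suc D)) (T * β D) ⟩
        suc D * (suc c * H (suc D)) + suc c * (T * β D) ∎))
        where
        D = d + j
        T = suc (m + D)
        x = d ∸ J * R
        D<N : m + D < N
        D<N = ≤-<-trans (≤-trans (≤-reflexive (sym (+-assoc m d j))) (+-monoʳ-≤ k (<⇒≤ j<J))) k+J<N
        lem₁ : ∀ D c h m → suc D * (c * h) + (suc c * (m * h) + suc D * h) ≡ suc c * (suc (m + D) * h)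
        lem₁ = solve-∀
        lem₂ : ∀ c D h b → c * (D * h + b) ≡ D * (c * h) + c * b
        lem₂ = solve-∀
        lem₃ : ∀ k b h x → k * (b * h * x) ≡ h * (k * b * x)
        lem₃ = solve-∀
        lem₄ : ∀ k d b h → k * (d * (b * h)) ≡ d * (k * b) * h
        lem₄ = solve-∀
        lem₅ : ∀ d m h₀ h → d * (m * h₀) * h ≡ h₀ * (d * m * h)
        lem₅ = solve-∀
        JR≤d : J * R ≤ d
        JR≤d = ≤-trans (m≤m+n _ _) 2JR≤d
        d≤2x : d ≤ 2 * x
        d≤2x = +-cancelʳ-≤ (2 * (J * R)) _ _ (≤-trans (+-monoʳ-≤ d 2JR≤d)
          (≤-reflexive (trans (cong (λ s → s + s) (sym (m∸n+n≡m JR≤d))) (lem x (J * R)))))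
          where
          lem : ∀ x y → x + y + (x + y) ≡ 2 * x + 2 * y
          lem = solve-∀
        0<x : 0 < x
        0<x with x | d≤2x
        ... | suc _ | _ = s≤s z≤n
        rate : k * β D * x ≤ d * m * H D
        rate = *-cancelˡ-≤ (H d₀) (begin
          H d₀ * (k * β D * x)
            ≤⟨ *-monoʳ-≤ (H d₀) (*-monoʳ-≤ (k * β D) (∸-monoʳ-≤ d (*-monoˡ-≤ R j<J))) ⟩
          H d₀ * (k * β D * (d ∸ suc j * R))
            ≡⟨ sym (lem₃ k (β D) (H d₀) (d ∸ suc j * R)) ⟩
          k * (β D * H d₀ * (d ∸ suc j * R))
            ≤⟨ *-monoʳ-≤ k (subst (λ s → β s * H d₀ * (d ∸ suc j * R) ≤ d * (β d₀ * H s)) (+-suc d₀ j)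
                 (growth-iterated d d₀ (suc j) (s≤s z≤n) ≤-refl (subst (λ s → m + s < N) (sym (+-suc d₀ j)) D<N))) ⟩
          k * (d * (β d₀ * H D))
            ≡⟨ lem₄ k d (β d₀) (H D) ⟩
          d * (k * β d₀) * H D
            ≤⟨ *-monoˡ-≤ (H D) (*-monoʳ-≤ d rate≤) ⟩
          d * (m * H d₀) * H D
            ≡⟨ lem₅ d m (H d₀) (H D) ⟩
          H d₀ * (d * m * H D) ∎)
        -- The error term with `R` comes from the growth of the rate, the other one from T ≤ k + J.
        -- Together they are at most 2kJ²m(R + 1), which `J-small` and d ≤ 2x bound by kxd.
        numeric : suc c * T * (d * m) ≤ k * x * (suc c * m + suc D)
        numeric = begin
          suc c * T * (d * m)
            ≤⟨ *-monoˡ-≤ (d * m) (*-monoʳ-≤ (suc c) (≤-trans (≤-reflexive (trans (cong suc (sym (+-assoc m d j))) (sym (+-suc k j)))) (+-monoʳ-≤ k j<J))) ⟩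
          suc c * (k + J) * (d * m)
            ≡⟨ cong₂ (λ s u → s * (k + J) * (u * m)) c+1≡2J (sym (m∸n+n≡m JR≤d)) ⟩
          2 * J * (k + J) * ((x + J * R) * m)
            ≡⟨ lem₆ J k x R m ⟩
          k * x * (2 * J * m) + (2 * (J * J * m * R) * k + 2 * (J * J * m) * (x + J * R))
            ≤⟨ +-monoʳ-≤ (k * x * (2 * J * m)) (+-monoʳ-≤ (2 * (J * J * m * R) * k)
                 (*-monoʳ-≤ (2 * (J * J * m)) (≤-trans (≤-reflexive (m∸n+n≡m JR≤d)) (m≤n+m d m)))) ⟩
          k * x * (2 * J * m) + (2 * (J * J * m * R) * k + 2 * (J * J * m) * k)
            ≡⟨ lem₇ (k * x * (2 * J * m)) J m R k ⟩
          k * x * (2 * J * m) + k * (2 * (J * J * m * suc R))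
            ≤⟨ +-monoʳ-≤ (k * x * (2 * J * m)) (*-monoʳ-≤ k (*-cancelˡ-≤ 4 (begin
                 4 * (2 * (J * J * m * suc R)) ≡⟨ sym (*-assoc 4 2 (J * J * m * suc R)) ⟩
                 8 * (J * J * m * suc R)       ≤⟨ J-small ⟩
                 d * d                         ≤⟨ *-monoˡ-≤ d d≤2x ⟩
                 2 * x * d                     ≤⟨ *-monoˡ-≤ d (*-monoˡ-≤ x {2} {4} (s≤s (s≤s z≤n))) ⟩
                 4 * x * d                     ≡⟨ *-assoc 4 x d ⟩
                 4 * (x * d)                   ∎))) ⟩
          k * x * (2 * J * m) + k * (x * d)
            ≤⟨ +-monoʳ-≤ (k * x * (2 * J * m)) (*-monoʳ-≤ k (*-monoʳ-≤ x (≤-trans (m≤m+n d j) (n≤1+n D)))) ⟩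
          k * x * (2 * J * m) + k * (x * suc D)
            ≡⟨ lem₈ k x (2 * J * m) (suc D) ⟩
          k * x * (2 * J * m + suc D)
            ≡⟨ cong (λ s → k * x * (s * m + suc D)) (sym c+1≡2J) ⟩
          k * x * (suc c * m + suc D) ∎
          where
          lem₆ : ∀ J k x R m → 2 * J * (k + J) * ((x + J * R) * m) ≡
            k * x * (2 * J * m) + (2 * (J * J * m * R) * k + 2 * (J * J * m) * (x + J * R))
          lem₆ = solve-∀
          lem₇ : ∀ a J m R k → a + (2 * (J * J * m * R) * k + 2 * (J * J * m) * k) ≡ a + k * (2 * (J * J * m * suc R))
          lem₇ = solve-∀
          lem₈ : ∀ k x a b → k * x * a + k * (x * b) ≡ k * x * (a + b)
          lem₈ = solve-∀
        main : suc c * (T * β D) ≤ suc c * (m * H D) + suc D * H D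
        main = *-cancelˡ-≤ (k * x) {{m*n≢0 k x {{k-nonZero}} {{>-nonZero 0<x}}}} (begin
          k * x * (suc c * (T * β D))           ≡⟨ lem₉ k x (suc c) T (β D) ⟩
          suc c * T * (k * β D * x)             ≤⟨ *-monoʳ-≤ (suc c * T) rate ⟩
          suc c * T * (d * m * H D)             ≡⟨ sym (*-assoc (suc c * T) (d * m) (H D)) ⟩
          suc c * T * (d * m) * H D             ≤⟨ *-monoˡ-≤ (H D) numeric ⟩
          k * x * (suc c * m + suc D) * H D     ≡⟨ lem₁₀ (k * x) (suc c) m (suc D) (H D) ⟩
          k * x * (suc c * (m * H D) + suc D * H D) ∎)
          where
          lem₉ : ∀ k x c t b → k * x * (c * (t * b)) ≡ c * t * (k * b * x)
          lem₉ = solve-∀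
          lem₁₀ : ∀ a c m s h → a * (c * m + s) * h ≡ a * (c * (m * h) + s * h)
          lem₁₀ = solve-∀

      -- Here T β / H ≥ m - (D + 1) / (2J - 1) is needed. Read backwards, `growth-iterated` bounds
      -- the rate at `D` below by the supercritical rate at `d₀` times 1 - jR / d′, where d′ = d - J
      -- is at most `suc D` throughout the window.
      down-step : m * H d₀ ≤ k * β d₀ → ∀ j D → j < J → suc D + j ≡ d → c * H (suc D) ≤ suc c * H D
      down-step rate≥ j D j<J D+j≡ = *-cancelˡ-≤ (suc D) (+-cancelʳ-≤ (c * (T * β D)) _ _ (begin
        suc D * (c * H (suc D)) + c * (T * β D)
          ≡⟨ lem₁ (suc D) c (H (suc D)) (T * β D) ⟩
        c * (suc D * H (suc D) + T * β D)
          ≡⟨ cong (c *_) (sym (balance D D<N)) ⟩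
        c * (T * H D)
          ≡⟨ lem₂ c m D (H D) ⟩
        c * (m * H D) + c * (suc D * H D)
          ≤⟨ +-monoˡ-≤ _ main ⟩
        suc D * H D + c * (T * β D) + c * (suc D * H D)
          ≡⟨ lem₃ D c (H D) (c * (T * β D)) ⟩
        suc D * (suc c * H D) + c * (T * β D) ∎))
        where
        T = suc (m + D)
        J≤d : J ≤ d
        J≤d = ≤-trans (m≤m+n _ _) 2J≤d
        d′ = d ∸ J
        y = d′ ∸ J * R
        d≡ : d′ + J ≡ d
        d≡ = m∸n+n≡m J≤d
        D+j≡d₀ : D + j ≡ d₀
        D+j≡d₀ = suc-injective D+j≡
        T+j≡k : T + j ≡ k
        T+j≡k = trans (cong suc (+-assoc m D j)) (trans (sym (+-suc m (D + j))) (cong (m +_) D+j≡))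
        d₀<N : m + d₀ < N
        d₀<N = ≤-<-trans (≤-trans (+-monoʳ-≤ m (n≤1+n d₀)) (m≤m+n k J)) k+J<N
        D<N : m + D < N
        D<N = ≤-<-trans (+-monoʳ-≤ m (≤-trans (m≤m+n D j) (≤-reflexive D+j≡d₀))) d₀<N
        d≤2d′ : d ≤ 2 * d′
        d≤2d′ = +-cancelʳ-≤ (2 * J) _ _ (≤-trans (+-monoʳ-≤ d 2J≤d)
          (≤-reflexive (trans (cong (λ s → s + s) (sym d≡)) (lem d′ J))))
          where
          lem : ∀ x y → x + y + (x + y) ≡ 2 * x + 2 * y
          lem = solve-∀
        0<d′ : 0 < d′
        0<d′ with d′ | d≤2d′
        ... | suc _ | _ = s≤s z≤n
        JR≤d′ : J * R ≤ d′
        JR≤d′ = *-cancelˡ-≤ 2 (≤-trans 2JR≤d d≤2d′)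
        d′≤D : d′ ≤ suc D
        d′≤D = +-cancelʳ-≤ J _ _ (≤-trans (≤-reflexive (trans d≡ (sym D+j≡))) (+-monoʳ-≤ (suc D) (<⇒≤ j<J)))
        y≤k : y ≤ k
        y≤k = ≤-trans (m∸n≤m d′ (J * R)) (≤-trans (m∸n≤m d J) (m≤n+m d m))
        lem₁ : ∀ D c h b → D * (c * h) + c * b ≡ c * (D * h + b)
        lem₁ = solve-∀
        lem₂ : ∀ c m D h → c * (suc (m + D) * h) ≡ c * (m * h) + c * (suc D * h)
        lem₂ = solve-∀
        lem₃ : ∀ D c h b → suc D * h + b + c * (suc D * h) ≡ suc D * (suc c * h) + b
        lem₃ = solve-∀
        rate : m * H D * y ≤ k * d′ * β D
        rate = *-cancelˡ-≤ (H d₀) (begin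
          H d₀ * (m * H D * y)
            ≤⟨ *-monoʳ-≤ (H d₀) (*-monoʳ-≤ (m * H D) (∸-monoʳ-≤ d′ (*-monoˡ-≤ R (<⇒≤ j<J)))) ⟩
          H d₀ * (m * H D * (d′ ∸ j * R))
            ≡⟨ lem₄ (H d₀) m (H D) (d′ ∸ j * R) ⟩
          m * H d₀ * (H D * (d′ ∸ j * R))
            ≤⟨ *-monoˡ-≤ (H D * (d′ ∸ j * R)) rate≥ ⟩
          k * β d₀ * (H D * (d′ ∸ j * R))
            ≡⟨ lem₅ k (β d₀) (H D) (d′ ∸ j * R) ⟩
          k * (β d₀ * H D * (d′ ∸ j * R))
            ≤⟨ *-monoʳ-≤ k (subst (λ s → β s * H D * (d′ ∸ j * R) ≤ d′ * (β D * H s)) D+j≡d₀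
                 (growth-iterated d′ D j 0<d′ d′≤D (subst (λ s → m + s < N) (sym D+j≡d₀) d₀<N))) ⟩
          k * (d′ * (β D * H d₀))
            ≡⟨ lem₆ k d′ (β D) (H d₀) ⟩
          H d₀ * (k * d′ * β D) ∎)
          where
          lem₄ : ∀ h m g y → h * (m * g * y) ≡ m * h * (g * y)
          lem₄ = solve-∀
          lem₅ : ∀ k b g y → k * b * (g * y) ≡ k * (b * g * y)
          lem₅ = solve-∀
          lem₆ : ∀ k d b h → k * (d * (b * h)) ≡ h * (k * d * b)
          lem₆ = solve-∀
        numeric : c * m * (k * d′) ≤ k * d′ * suc D + c * T * (m * y)
        numeric = begin
          c * m * (k * d′)
            ≡⟨ cong (λ s → c * m * (k * s)) (sym (m∸n+n≡m JR≤d′)) ⟩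
          c * m * (k * (y + J * R))
            ≡⟨ lem₇ c m k y (J * R) ⟩
          c * m * (y * k) + c * m * (k * (J * R))
            ≡⟨ cong (λ s → c * m * (y * s) + c * m * (k * (J * R))) (sym T+j≡k) ⟩
          c * m * (y * (T + j)) + c * m * (k * (J * R))
            ≡⟨ lem₈ c m y T j (k * (J * R)) ⟩
          c * T * (m * y) + c * m * (j * y + k * (J * R))
            ≤⟨ +-monoʳ-≤ (c * T * (m * y)) (*-mono-≤ (*-monoˡ-≤ m (≤-trans (n≤1+n c) (≤-reflexive c+1≡2J)))
                 (+-monoˡ-≤ (k * (J * R)) (*-mono-≤ (<⇒≤ j<J) y≤k))) ⟩
          c * T * (m * y) + 2 * J * m * (J * k + k * (J * R))
            ≡⟨ lem₉ (c * T * (m * y)) J m k R ⟩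
          k * (2 * (J * J * m * suc R)) + c * T * (m * y)
            ≤⟨ +-monoˡ-≤ (c * T * (m * y)) (*-monoʳ-≤ k (*-cancelˡ-≤ 4 (begin
                 4 * (2 * (J * J * m * suc R)) ≡⟨ sym (*-assoc 4 2 (J * J * m * suc R)) ⟩
                 8 * (J * J * m * suc R)       ≤⟨ J-small ⟩
                 d * d                         ≤⟨ *-mono-≤ d≤2d′ d≤2d′ ⟩
                 2 * d′ * (2 * d′)             ≡⟨ lem₁₀ d′ ⟩
                 4 * (d′ * d′)                 ≤⟨ *-monoʳ-≤ 4 (*-monoʳ-≤ d′ d′≤D) ⟩
                 4 * (d′ * suc D)              ∎))) ⟩
          k * (d′ * suc D) + c * T * (m * y)
            ≡⟨ cong (_+ c * T * (m * y)) (sym (*-assoc k d′ (suc D))) ⟩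
          k * d′ * suc D + c * T * (m * y) ∎
          where
          lem₇ : ∀ c m k y s → c * m * (k * (y + s)) ≡ c * m * (y * k) + c * m * (k * s)
          lem₇ = solve-∀
          lem₈ : ∀ c m y t j s → c * m * (y * (t + j)) + c * m * s ≡ c * t * (m * y) + c * m * (j * y + s)
          lem₈ = solve-∀
          lem₉ : ∀ a J m k R → a + 2 * J * m * (J * k + k * (J * R)) ≡ k * (2 * (J * J * m * suc R)) + a
          lem₉ = solve-∀
          lem₁₀ : ∀ d → 2 * d * (2 * d) ≡ 4 * (d * d)
          lem₁₀ = solve-∀
        main : c * (m * H D) ≤ suc D * H D + c * (T * β D)
        main = *-cancelˡ-≤ (k * d′) {{m*n≢0 k d′ {{k-nonZero}} {{>-nonZero 0<d′}}}} (begin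
          k * d′ * (c * (m * H D))                            ≡⟨ lem₁₁ (k * d′) c m (H D) ⟩
          c * m * (k * d′) * H D                              ≤⟨ *-monoˡ-≤ (H D) numeric ⟩
          (k * d′ * suc D + c * T * (m * y)) * H D            ≡⟨ lem₁₂ (k * d′) (suc D) c T m y (H D) ⟩
          k * d′ * (suc D * H D) + c * T * (m * H D * y)      ≤⟨ +-monoʳ-≤ (k * d′ * (suc D * H D)) (*-monoʳ-≤ (c * T) rate) ⟩
          k * d′ * (suc D * H D) + c * T * (k * d′ * β D)     ≡⟨ lem₁₃ (k * d′) (suc D * H D) c T (β D) ⟩
          k * d′ * (suc D * H D + c * (T * β D))              ∎)
          where
          lem₁₁ : ∀ a c m h → a * (c * (m * h)) ≡ c * m * a * h
          lem₁₁ = solve-∀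
          lem₁₂ : ∀ a s c t m y h → (a * s + c * t * (m * y)) * h ≡ a * (s * h) + c * t * (m * h * y)
          lem₁₂ = solve-∀
          lem₁₃ : ∀ a s c t b → a * s + c * t * (a * b) ≡ a * (s + c * (t * b))
          lem₁₃ = solve-∀

      window′ : (∀ j → j ≤ J → H d ≤ 2 * H (d + j)) ⊎ (∀ j → j ≤ J → H d ≤ 2 * H (d ∸ j))
      window′ with ≤-total (k * β d₀) (m * H d₀)
      ... | inj₁ p = inj₁ (λ j j≤J → subst (λ s → H s ≤ 2 * H (d + j)) (+-identityʳ d)
            (slow-decay c J (λ j → H (d + j)) c+1≡2J
              (λ j j<J → subst (λ s → c * H (d + j) ≤ suc c * H s) (sym (+-suc d j)) (up-step p j j<J)) j j≤J))
      ... | inj₂ p = inj₂ (slow-decay c J (λ j → H (d ∸ j)) c+1≡2J (λ j j<J →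
            subst (λ s → c * H s ≤ suc c * H (d ∸ suc j)) (suc-∸ j j<J)
              (down-step p j (d ∸ suc j) j<J (trans (sym (+-suc (d ∸ suc j) j)) (m∸n+n≡m (<⇒≤d j<J))))))
        where
        <⇒≤d : ∀ {j} → j < J → suc j ≤ d
        <⇒≤d j<J = ≤-trans j<J (≤-trans (m≤m+n _ _) 2J≤d)
        suc-∸ : ∀ j → j < J → suc (d ∸ suc j) ≡ d ∸ j
        suc-∸ j j<J = sym (+-∸-assoc 1 (<⇒≤d j<J))

    window : ∀ d J → 0 < J → 8 * (J * J * m * suc R) ≤ d * d → 2 * J ≤ d → 2 * (J * R) ≤ d → m + d + J < N →
      (∀ j → j ≤ J → H d ≤ 2 * H (d + j)) ⊎ (∀ j → j ≤ J → H d ≤ 2 * H (d ∸ j))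
    window zero     (suc J) _ _ () _ _
    window (suc d₀) (suc J) _ J-small 2J≤d 2JR≤d bound with H d₀ in eqH
    ... | zero  = inj₁ λ j _ → subst (_≤ 2 * H (suc d₀ + j)) (sym (H-vanishes d₀ d₀<N eqH)) z≤n
      -- With `H d₀` zero there is no rate to test, but then `H (suc d₀)` is zero as well and the
      -- claim is trivial.
      where d₀<N = ≤-<-trans (≤-trans (+-monoʳ-≤ m (n≤1+n d₀)) (m≤m+n (m + suc d₀) (suc J))) bound
    -- The value of `c` is 2(J + 1) - 1, written so that `suc c ≡ 2 * suc J` holds by `refl`.
    ... | suc _ = window′ d₀ (suc J) (J + suc (J + 0)) refl J-small 2J≤d 2JR≤d bound (subst (0 <_) (sym eqH) (s≤s z≤n))

  -- Counting small subsets

  le : ℕ → ℕ → ℕ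
  le a r = ind (a <ᵇ suc r)

  le-yes : ∀ {a r} → a ≤ r → le a r ≡ 1
  le-yes z≤n     = refl
  le-yes (s≤s p) = le-yes p

  -- Give s ⊆ B the weight q ^ (r - |s|): it is at least 1 if |s| ≤ r, and the weights add up to q ^ r (1 + 1/q) ^ |B|.
  smallSubsets≤ : ∀ (B : Subset n) q r → 0 < q →
    ∑ (allSubsets n) (λ s → ind (does (s ⊆? B)) * le ∣ s ∣ r) * q ^ ∣ B ∣ ≤ q ^ r * suc q ^ ∣ B ∣
  smallSubsets≤ [] q r 0<q = subst (_≤ q ^ r * 1) (sym (trans (*-identityʳ _) (trans (+-identityʳ _) (+-identityʳ 1))))
    (≤-trans (m^n>0 q {{>-nonZero 0<q}} r) (≤-reflexive (sym (*-identityʳ _))))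
  smallSubsets≤ {suc n} (outside ∷ B) q r 0<q = subst (λ s → s * q ^ ∣ B ∣ ≤ q ^ r * suc q ^ ∣ B ∣)
    (sym (trans (∑-allSubsets-suc n _) (trans (cong (S +_) (∑-zero (allSubsets n))) (+-identityʳ S))))
    (smallSubsets≤ B q r 0<q)
    where S = ∑ (allSubsets n) (λ s → ind (does (s ⊆? B)) * le ∣ s ∣ r)
  smallSubsets≤ {suc n} (inside ∷ B) q r 0<q = subst (λ s → s * (q * q ^ ∣ B ∣) ≤ q ^ r * (suc q * suc q ^ ∣ B ∣))
    (sym (∑-allSubsets-suc n (λ s → ind (does (s ⊆? (inside ∷ B))) * le ∣ s ∣ r))) (split r)
    where
    open ≤-Reasoning
    S : ℕ → ℕ
    S r = ∑ (allSubsets n) (λ s → ind (does (s ⊆? B)) * le ∣ s ∣ r)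
    split : ∀ r → (S r + ∑ (allSubsets n) (λ s → ind (does (s ⊆? B)) * le (suc ∣ s ∣) r)) * (q * q ^ ∣ B ∣) ≤
      q ^ r * (suc q * suc q ^ ∣ B ∣)
    split zero = begin
      (S 0 + ∑ (allSubsets n) (λ s → ind (does (s ⊆? B)) * 0)) * (q * q ^ ∣ B ∣)
        ≡⟨ cong (λ z → (S 0 + z) * (q * q ^ ∣ B ∣)) (trans (∑-cong (allSubsets n) (λ s → *-zeroʳ (ind (does (s ⊆? B))))) (∑-zero (allSubsets n))) ⟩
      (S 0 + 0) * (q * q ^ ∣ B ∣)
        ≡⟨ lem (S 0) q (q ^ ∣ B ∣) ⟩
      q * (S 0 * q ^ ∣ B ∣)
        ≤⟨ *-mono-≤ (n≤1+n q) (smallSubsets≤ B q 0 0<q) ⟩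
      suc q * (1 * suc q ^ ∣ B ∣)
        ≡⟨ lem′ (suc q) (suc q ^ ∣ B ∣) ⟩
      1 * (suc q * suc q ^ ∣ B ∣) ∎
      where
      lem : ∀ a q x → (a + 0) * (q * x) ≡ q * (a * x)
      lem = solve-∀
      lem′ : ∀ a x → a * (1 * x) ≡ 1 * (a * x)
      lem′ = solve-∀
    split (suc r) = begin
      (S (suc r) + S r) * (q * q ^ ∣ B ∣)
        ≡⟨ lem (S (suc r)) (S r) q (q ^ ∣ B ∣) ⟩
      q * (S (suc r) * q ^ ∣ B ∣) + q * (S r * q ^ ∣ B ∣)
        ≤⟨ +-mono-≤ (*-monoʳ-≤ q (smallSubsets≤ B q (suc r) 0<q)) (*-monoʳ-≤ q (smallSubsets≤ B q r 0<q)) ⟩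
      q * (q * q ^ r * suc q ^ ∣ B ∣) + q * (q ^ r * suc q ^ ∣ B ∣)
        ≡⟨ lem′ q (q ^ r) (suc q ^ ∣ B ∣) ⟩
      q * q ^ r * (suc q * suc q ^ ∣ B ∣) ∎
      where
      lem : ∀ a b q x → (a + b) * (q * x) ≡ q * (a * x) + q * (b * x)
      lem = solve-∀
      lem′ : ∀ q a x → q * (q * a * x) + q * (a * x) ≡ q * a * (suc q * x)
      lem′ = solve-∀

  -- Edges and non-isolated vertices inside a set

  ⊆?-split : ∀ (s A : Subset n) x → ind (does (s ⊆? A)) ≡ ind (does (s ⊆? (A ∖′ x))) + ind (does (s ⊆? A)) * χ s x
  ⊆?-split (outside ∷ s) (a ∷ A)       zero    = sym (trans (cong (ind (does (s ⊆? A)) +_) (*-zeroʳ (ind (does (s ⊆? A))))) (+-identityʳ _))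
  ⊆?-split (inside ∷ s)  (outside ∷ A) zero    = refl
  ⊆?-split (inside ∷ s)  (inside ∷ A)  zero    = sym (*-identityʳ _)
  ⊆?-split (outside ∷ s) (a ∷ A)       (suc x) = ⊆?-split s A x
  ⊆?-split (inside ∷ s)  (outside ∷ A) (suc x) = refl
  ⊆?-split (inside ∷ s)  (inside ∷ A)  (suc x) = ⊆?-split s A x

  ∖′-absent : ∀ (A : Subset n) x → lookup A x ≡ false → A ∖′ x ≡ A
  ∖′-absent A x p = trans (cong (A [ x ]≔_) (sym p)) ([]≔-lookup A x)

  ∪′-∖′ : ∀ (A : Subset n) x → lookup A x ≡ false → A ∪′ x ∖′ x ≡ A
  ∪′-∖′ A x p = trans ([]≔-idempotent A x) (∖′-absent A x p)

  χ-true : ∀ (A : Subset n) x → lookup A x ≡ true → χ A x ≡ 1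
  χ-true A x p = cong ind p

  χ≤1 : ∀ (A : Subset n) x → χ A x ≤ 1
  χ≤1 A x with lookup A x
  ... | true  = ≤-refl
  ... | false = z≤n

  *-pos : ∀ a b → 0 < a * b → 0 < a × 0 < b
  *-pos (suc a) (suc b) p = s≤s z≤n , s≤s z≤n
  *-pos (suc a) zero    p = contradiction (subst (0 <_) (*-zeroʳ a) p) λ ()

  module EdgeCount {n : ℕ} (G : Hypergraph n) (r : ℕ) (rank : RankAtMost r G) where

    E : Subset n → Subset n → ℕ
    E A s = ind (isEdge G s ∧ does (s ⊆? A))

    -- `core A` is the number of non-isolated vertices of the subhypergraph induced by `A`, the m of
    -- the overview.
    edges core : Subset n → ℕ
    deg : Subset n → Fin n → ℕ
    edges A = ∑ (allSubsets n) (E A)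
    deg A x = ∑ (allSubsets n) (λ s → E A s * χ s x)
    core A = ∑ (allFin n) (λ x → pos (deg A x))

    edgesIn≡edges : ∀ A → edgesIn G A ≡ edges A
    edgesIn≡edges A = trans (length-filter (λ s → (isEdge G s ∧ ⌊ s ⊆? A ⌋) Bool.≟ true) (allSubsets n))
      (∑-cong (allSubsets n) (λ s → trans (≟-true (isEdge G s ∧ ⌊ s ⊆? A ⌋)) (cong (λ b → ind (isEdge G s ∧ b)) (isYes≗does (s ⊆? A)))))
      where
      ≟-true : ∀ b → ind (does (b Bool.≟ true)) ≡ ind b
      ≟-true true  = refl
      ≟-true false = refl

    E-split : ∀ A x s → E A s ≡ E (A ∖′ x) s + E A s * χ s x
    E-split A x s with isEdge G s
    ... | true  = ⊆?-split s A x
    ... | false = refl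

    E-edge : ∀ A s → 0 < E A s → isEdge G s ≡ true
    E-edge A s p with isEdge G s
    ... | true  = refl
    ... | false = contradiction p λ ()

    E≤1 : ∀ A s → E A s ≤ 1
    E≤1 A s with isEdge G s ∧ does (s ⊆? A)
    ... | true  = ≤-refl
    ... | false = z≤n

    edges-split : ∀ A x → edges A ≡ edges (A ∖′ x) + deg A x
    edges-split A x = trans (∑-cong (allSubsets n) (E-split A x)) (∑-+ (allSubsets n) _ _)

    edges-∖′≤ : ∀ A x → edges (A ∖′ x) ≤ edges A
    edges-∖′≤ A x = ≤-trans (m≤m+n _ (deg A x)) (≤-reflexive (sym (edges-split A x)))

    E-∖′≡ : ∀ A x → deg A x ≡ 0 → ∀ s → E (A ∖′ x) s ≡ E A s
    E-∖′≡ A x p s = sym (trans (E-split A x s) (trans (cong (E (A ∖′ x) s +_)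
      (n≤0⇒n≡0 (≤-trans (∑-term (allSubsets n) (∈-allSubsets s)) (≤-reflexive p)))) (+-identityʳ _)))

    edges-∖′≡ : ∀ A x → deg A x ≡ 0 → edges (A ∖′ x) ≡ edges A
    edges-∖′≡ A x p = ∑-cong (allSubsets n) (E-∖′≡ A x p)

    core-∖′≡ : ∀ A x → deg A x ≡ 0 → core (A ∖′ x) ≡ core A
    core-∖′≡ A x p = ∑-cong (allFin n) (λ z → cong pos (∑-cong (allSubsets n) (λ s → cong (_* χ s z) (E-∖′≡ A x p s))))

    edges-∖′< : ∀ A x → 0 < deg A x → edges (A ∖′ x) < edges A
    edges-∖′< A x p = subst (edges (A ∖′ x) <_) (sym (edges-split A x)) (m<m+n _ p)

    deg-absent : ∀ A x → lookup A x ≡ false → deg A x ≡ 0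
    deg-absent A x p = +-cancelˡ-≡ (edges A) _ _ (trans (cong (λ B → edges B + deg A x) (sym (∖′-absent A x p)))
      (trans (sym (edges-split A x)) (sym (+-identityʳ _))))

    core≤ : ∀ A → core A ≤ r * edges A
    core≤ A = begin
      core A                                                              ≤⟨ ∑-mono (allFin n) (λ x → pos≤ (deg A x)) ⟩
      ∑ (allFin n) (λ x → ∑ (allSubsets n) (λ s → E A s * χ s x))         ≡⟨ ∑-comm (allFin n) (allSubsets n) _ ⟩
      ∑ (allSubsets n) (λ s → ∑ (allFin n) (λ x → E A s * χ s x))         ≡⟨ ∑-cong (allSubsets n) (λ s → trans (∑-*ˡ (E A s) (allFin n) (χ s)) (cong (E A s *_) (sym (∣p∣≡∑χ s)))) ⟩
      ∑ (allSubsets n) (λ s → E A s * ∣ s ∣)                              ≤⟨ ∑-mono (allSubsets n) size ⟩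
      ∑ (allSubsets n) (λ s → r * E A s)                                  ≡⟨ ∑-*ˡ r (allSubsets n) (E A) ⟩
      r * edges A                                                         ∎
      where
      open ≤-Reasoning
      pos≤ : ∀ a → pos a ≤ a
      pos≤ zero    = z≤n
      pos≤ (suc a) = s≤s z≤n
      size : ∀ s → E A s * ∣ s ∣ ≤ r * E A s
      size s with E A s in eqE
      ... | zero  = z≤n
      ... | suc e = ≤-trans (*-monoʳ-≤ (suc e) (rank s (E-edge A s (subst (0 <_) (sym eqE) (s≤s z≤n))))) (≤-reflexive (*-comm (suc e) r))

    -- All edges inside `A` consist of core vertices, so they are among the small subsets of
    -- `coreSet`. The base `q` stays free; it will be 2z².
    edges≤ : ∀ A q → 0 < q → edges A * q ^ core A ≤ q ^ r * suc q ^ core A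
    edges≤ A q 0<q = subst (λ c → edges A * q ^ c ≤ q ^ r * suc q ^ c) ∣coreSet∣≡core
      (≤-trans (*-monoˡ-≤ (q ^ ∣ coreSet ∣) (∑-mono (allSubsets n) inCoreSet)) (smallSubsets≤ coreSet q r 0<q))
      where
      positive : ℕ → Bool
      positive zero    = false
      positive (suc _) = true
      coreSet : Subset n
      coreSet = tabulateᵛ (λ x → positive (deg A x))
      ind-positive : ∀ a → ind (positive a) ≡ pos a
      ind-positive zero    = refl
      ind-positive (suc a) = refl
      ∣coreSet∣≡core : ∣ coreSet ∣ ≡ core A
      ∣coreSet∣≡core = trans (∣p∣≡∑χ coreSet) (∑-cong (allFin n) (λ x →
        trans (cong ind (lookup∘tabulate (λ x → positive (deg A x)) x)) (ind-positive (deg A x))))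
      positive-yes : ∀ {a} → 0 < a → positive a ≡ true
      positive-yes {suc a} p = refl
      inCoreSet : ∀ s → E A s ≤ ind (does (s ⊆? coreSet)) * le ∣ s ∣ r
      inCoreSet s with E A s in eqE
      ... | zero  = z≤n
      ... | suc e = subst (suc e ≤_) (sym (cong₂ (λ u v → ind u * v) (dec-true (s ⊆? coreSet) s⊆coreSet)
                      (le-yes (rank s (E-edge A s (subst (0 <_) (sym eqE) (s≤s z≤n))))))) (subst (_≤ 1) eqE (E≤1 A s))
        where
        s⊆coreSet : s ⊆ coreSet
        s⊆coreSet {x} x∈s = lookup⇒[]= x coreSet (trans (lookup∘tabulate (λ x → positive (deg A x)) x) (positive-yes
          (≤-trans (subst (0 <_) (sym (cong₂ _*_ eqE (χ-true s x ([]=⇒lookup x∈s)))) (s≤s z≤n))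
                   (∑-term (allSubsets n) (∈-allSubsets s)))))

    module _ (ℓ m : ℕ) where

      φ : Subset n → ℕ
      φ A = eq (edges A) ℓ * eq (core A) m

      φ-yes : ∀ {A} → edges A ≡ ℓ → core A ≡ m → φ A ≡ 1
      φ-yes p q = cong₂ _*_ (eq-≡ p) (eq-≡ q)

      φ-edges : ∀ A → 0 < φ A → edges A ≡ ℓ
      φ-edges A p = eq-pos _ _ (proj₁ (*-pos (eq (edges A) ℓ) _ p))

      φ-core : ∀ A → 0 < φ A → core A ≡ m
      φ-core A p = eq-pos _ _ (proj₂ (*-pos (eq (edges A) ℓ) _ p))

      φ01 : ∀ A → φ A ≡ 0 ⊎ φ A ≡ 1
      φ01 A with φ A in eqφ
      ... | zero  = inj₁ refl
      ... | suc _ = inj₂ (trans (sym eqφ) (φ-yes {A} (φ-edges A 0<φ) (φ-core A 0<φ)))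
        where 0<φ = subst (0 <_) (sym eqφ) (s≤s z≤n)

      ≡1⇒pos : ∀ {a} → a ≡ 1 → 0 < a
      ≡1⇒pos refl = s≤s z≤n

      -- Removing a non-isolated vertex destroys an edge and so leaves the family; removing an
      -- isolated one changes neither count. Hence exactly the `m` core vertices are not removable.
      removable : ∀ A → φ A ≡ 1 → ∑ (allFin n) (λ x → χ A x * φ (A ∖′ x)) + m ≡ ∣ A ∣
      removable A φ≡1 = trans (cong (∑ (allFin n) (λ x → χ A x * φ (A ∖′ x)) +_) (sym (φ-core A (≡1⇒pos φ≡1))))
        (trans (sym (∑-+ (allFin n) _ _)) (trans (∑-cong (allFin n) pointwise) (sym (∣p∣≡∑χ A))))
        where
        pointwise : ∀ x → χ A x * φ (A ∖′ x) + pos (deg A x) ≡ χ A x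
        pointwise x with deg A x in eqd
        ... | zero = trans (+-identityʳ _) (trans (cong (χ A x *_) (trans (cong₂ (λ a b → eq a ℓ * eq b m)
                       (edges-∖′≡ A x eqd) (core-∖′≡ A x eqd)) φ≡1)) (*-identityʳ _))
        ... | suc e = trans (cong (_+ 1) (trans (cong (χ A x *_) φ≡0) (*-zeroʳ (χ A x)))) (sym χ≡1)
          where
          0<deg : 0 < deg A x
          0<deg = subst (0 <_) (sym eqd) (s≤s z≤n)
          φ≡0 : φ (A ∖′ x) ≡ 0
          φ≡0 = cong (_* eq (core (A ∖′ x)) m)
            (eq-≢ (<⇒≢ (subst (edges (A ∖′ x) <_) (φ-edges A (≡1⇒pos φ≡1)) (edges-∖′< A x 0<deg))))
          χ≡1 : χ A x ≡ 1
          χ≡1 with lookup A x in eqx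
          ... | true  = refl
          ... | false = contradiction (trans (sym eqd) (deg-absent A x eqx)) λ ()

      -- If y is blocked by an edge s, then only removing a vertex of s can unblock it.
      fewUnblockers : ∀ D y → φ D ≡ 1 → lookup D y ≡ false → φ (D ∪′ y) ≡ 0 →
        ∑ (allFin n) (λ x → χ D x * (φ (D ∖′ x) * φ (D ∖′ x ∪′ y))) ≤ r
      fewUnblockers D y φD y∉D φU with deg (D ∪′ y) y in eqd
      -- A new vertex of degree zero changes neither edges nor core, so it cannot be blocked.
      ... | zero = contradiction (trans (sym φU) (trans (sym (cong₂ (λ a b → eq a ℓ * eq b m)
                     (trans (cong edges (sym (∪′-∖′ D y y∉D))) (edges-∖′≡ (D ∪′ y) y eqd))
                     (trans (cong core (sym (∪′-∖′ D y y∉D))) (core-∖′≡ (D ∪′ y) y eqd)))) φD)) λ ()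
      ... | suc e with ∑-pos⇒∃ (allSubsets n) (subst (0 <_) (sym eqd) (s≤s z≤n))
      ... | s , 0<Eχ = ≤-trans (∑-mono (allFin n) inEdge) (≤-trans (≤-reflexive (sym (∣p∣≡∑χ s)))
                         (rank s (E-edge (D ∪′ y) s (proj₁ (*-pos (E (D ∪′ y) s) _ 0<Eχ)))))
        where
        inEdge : ∀ x → χ D x * (φ (D ∖′ x) * φ (D ∖′ x ∪′ y)) ≤ χ s x
        inEdge x with χ D x * (φ (D ∖′ x) * φ (D ∖′ x ∪′ y)) in eqT | lookup s x in eqs
        ... | zero  | _     = z≤n
        ... | suc t | true  = subst (_≤ 1) eqT (*-mono-≤ (χ≤1 D x) (*-mono-≤ (φ≤1 (D ∖′ x)) (φ≤1 (D ∖′ x ∪′ y))))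
          where
          φ≤1 : ∀ A → φ A ≤ 1
          φ≤1 A with φ01 A
          ... | inj₁ q rewrite q = z≤n
          ... | inj₂ q rewrite q = ≤-refl
        -- If x is not in `s`, then `s` survives in `U` and contains `y`, so `U` has more edges than
        -- `U` without `y`, that is, than `D` without `x`. But both are members and have `ℓ` edges.
        ... | suc t | false = contradiction (edges-∖′< U y 0<degU) (≤⇒≯ (≤-reflexive edges≡))
          where
          U : Subset n
          U = D ∖′ x ∪′ y
          factors : 0 < χ D x × 0 < φ (D ∖′ x) × 0 < φ U
          factors with *-pos (χ D x) _ (subst (0 <_) (sym eqT) (s≤s z≤n))
          ... | a , b = a , *-pos (φ (D ∖′ x)) _ b
          x≢y : ¬ x ≡ y
          x≢y refl = contradiction (subst (λ b → 0 < ind b) y∉D (proj₁ factors)) λ ()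
          U≡ : U ≡ D ∪′ y ∖′ x
          U≡ = []≔-commutes D x y x≢y
          y∉D∖x : lookup (D ∖′ x) y ≡ false
          y∉D∖x = trans (lookup∘update′ (x≢y ∘ sym) D false) y∉D
          edges≡ : edges U ≡ edges (U ∖′ y)
          edges≡ = trans (φ-edges U (proj₂ (proj₂ factors))) (trans (sym (φ-edges (D ∖′ x) (proj₁ (proj₂ factors))))
            (cong edges (sym (∪′-∖′ (D ∖′ x) y y∉D∖x))))
          EU≡ : E U s ≡ E (D ∪′ y) s
          EU≡ = trans (cong (λ A → E A s) U≡) (sym (trans (E-split (D ∪′ y) x s)
            (trans (cong (λ b → E (D ∪′ y ∖′ x) s + E (D ∪′ y) s * ind b) eqs)
              (trans (cong (E (D ∪′ y ∖′ x) s +_) (*-zeroʳ (E (D ∪′ y) s))) (+-identityʳ _)))))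
          0<degU : 0 < deg U y
          0<degU = ≤-trans (subst (0 <_) (cong (_* χ s y) (sym EU≡)) 0<Eχ) (∑-term (allSubsets n) (∈-allSubsets s))

      open Family φ m r φ01 removable fewUnblockers public

    -- Along a chain of sets the edge count reaches ℓ at most once, by adding a vertex of the core.
    module _ (ℓ : ℕ) where

      -- By truncated subtraction this is the indicator of `ℓ ≤ edges A`.
      atLeast : Subset n → ℕ
      atLeast A = pos (suc (edges A) ∸ ℓ)

      above : ℕ → ℕ
      above t = ∑ (allSubsets n) (λ A → eq ∣ A ∣ t * atLeast A)

      -- Counts the pairs (A , x) in which `x`, added last, brings the number of edges of `A` up to
      -- exactly `ℓ`.
      coreMass : ℕ → ℕ
      coreMass t = ∑ (allSubsets n) (λ A → eq ∣ A ∣ t * (eq (edges A) ℓ * core A))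

      atLeast-mono : ∀ {A B} → edges A ≤ edges B → atLeast A ≤ atLeast B
      atLeast-mono {A} {B} p = pos-mono (∸-monoˡ-≤ ℓ (s≤s p))
        where
        pos-mono : ∀ {a b} → a ≤ b → pos a ≤ pos b
        pos-mono z≤n     = z≤n
        pos-mono (s≤s p) = ≤-refl

      -- Without a core vertex `x`, a set with exactly `ℓ` edges falls below `ℓ`. So the two terms
      -- on the left exclude each other, and each of them forces `A` to have at least `ℓ` edges.
      firstTime : ∀ A x → χ A x * atLeast (A ∖′ x) + eq (edges A) ℓ * pos (deg A x) ≤ χ A x * atLeast A
      firstTime A x with deg A x in eqd | lookup A x in eqx
      ... | zero | b rewrite *-zeroʳ (eq (edges A) ℓ) | +-identityʳ (ind b * atLeast (A ∖′ x)) =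
            *-monoʳ-≤ (ind b) (atLeast-mono {A ∖′ x} {A} (edges-∖′≤ A x))
      ... | suc e | false = contradiction (trans (sym eqd) (deg-absent A x eqx)) λ ()
      ... | suc e | true with edges A ≟ ℓ
      ...   | no ¬p rewrite eq-≢ ¬p | +-identityʳ (1 * atLeast (A ∖′ x)) =
              *-monoʳ-≤ 1 (atLeast-mono {A ∖′ x} {A} (edges-∖′≤ A x))
      ...   | yes p = ≤-reflexive (trans (cong₂ (λ a b → 1 * a + b * 1) atLeast≡0 (eq-≡ p)) (sym (cong (1 *_) atLeast≡1)))
        where
        atLeast≡0 : atLeast (A ∖′ x) ≡ 0
        atLeast≡0 = cong pos (m≤n⇒m∸n≡0 (subst (edges (A ∖′ x) <_) p (edges-∖′< A x (subst (0 <_) (sym eqd) (s≤s z≤n)))))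
        atLeast≡1 : atLeast A ≡ 1
        atLeast≡1 = cong pos (+-∸-assoc 1 (≤-reflexive (sym p)))

      -- `firstTime` is summed over all pairs (A , x) with A of size `suc t`; every set of size `t`
      -- then arises from `u` pairs.
      above-step : ∀ t u → t + u ≡ n → coreMass (suc t) + u * above t ≤ suc t * above (suc t)
      above-step t u t+u≡n = begin
        coreMass (suc t) + u * above t
          ≡⟨ +-comm (coreMass (suc t)) (u * above t) ⟩
        u * above t + coreMass (suc t)
          ≡⟨ cong₂ _+_ lower upper ⟩
        ∑ (allSubsets n) (λ A → ∑ (allFin n) (λ x → χ A x * F A (A ∖′ x))) +
        ∑ (allSubsets n) (λ A → ∑ (allFin n) (λ x → eq ∣ A ∣ (suc t) * (eq (edges A) ℓ * pos (deg A x))))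
          ≡⟨ sym (trans (∑-cong (allSubsets n) (λ A → ∑-+ (allFin n) _ _)) (∑-+ (allSubsets n) _ _)) ⟩
        ∑ (allSubsets n) (λ A → ∑ (allFin n) (λ x → χ A x * F A (A ∖′ x) + eq ∣ A ∣ (suc t) * (eq (edges A) ℓ * pos (deg A x))))
          ≤⟨ ∑-mono (allSubsets n) (λ A → ∑-mono (allFin n) (λ x → ≤-trans
               (≤-reflexive (lem₁ (χ A x) (eq ∣ A ∣ (suc t)) (atLeast (A ∖′ x)) (eq (edges A) ℓ * pos (deg A x))))
               (*-monoʳ-≤ (eq ∣ A ∣ (suc t)) (firstTime A x)))) ⟩
        ∑ (allSubsets n) (λ A → ∑ (allFin n) (λ x → eq ∣ A ∣ (suc t) * (χ A x * atLeast A)))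
          ≡⟨ ∑-cong (allSubsets n) (λ A → trans (∑-*ˡ (eq ∣ A ∣ (suc t)) (allFin n) _)
               (trans (eq-*-cong (λ p → trans (∑-*ʳ (atLeast A) (allFin n) (χ A)) (cong (_* atLeast A) (trans (sym (∣p∣≡∑χ A)) p))))
                 (lem₂ (eq ∣ A ∣ (suc t)) (suc t) (atLeast A)))) ⟩
        ∑ (allSubsets n) (λ A → suc t * (eq ∣ A ∣ (suc t) * atLeast A))
          ≡⟨ ∑-*ˡ (suc t) (allSubsets n) _ ⟩
        suc t * above (suc t) ∎
        where
        open ≤-Reasoning
        F : Subset n → Subset n → ℕ
        F A K = eq ∣ A ∣ (suc t) * atLeast K
        lem₁ : ∀ c e a b → c * (e * a) + e * b ≡ e * (c * a + b)
        lem₁ = solve-∀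
        lem₂ : ∀ e t a → e * (t * a) ≡ t * (e * a)
        lem₂ = solve-∀
        upper : coreMass (suc t) ≡ ∑ (allSubsets n) (λ A → ∑ (allFin n) (λ x → eq ∣ A ∣ (suc t) * (eq (edges A) ℓ * pos (deg A x))))
        upper = ∑-cong (allSubsets n) (λ A → sym (trans (∑-*ˡ (eq ∣ A ∣ (suc t)) (allFin n) _)
          (cong (eq ∣ A ∣ (suc t) *_) (∑-*ˡ (eq (edges A) ℓ) (allFin n) _))))
        lower : u * above t ≡ ∑ (allSubsets n) (λ A → ∑ (allFin n) (λ x → χ A x * F A (A ∖′ x)))
        lower = trans (sym (∑-*ˡ u (allSubsets n) _)) (trans (∑-cong (allSubsets n) (λ K → trans
            (trans (lem₃ u (eq ∣ K ∣ t) (atLeast K)) (trans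
              (eq-*-cong {∣ K ∣} {t} (λ p → cong (_* atLeast K) (+-cancelˡ-≡ t _ _ (trans t+u≡n (trans (sym (∑χ+∑χ̄ K)) (cong (_+ ∑ (allFin n) (χ̄ K)) p))))))
              (lem₄ (eq ∣ K ∣ t) (∑ (allFin n) (χ̄ K)) (atLeast K))))
            (trans (sym (∑-*ʳ (eq ∣ K ∣ t * atLeast K) (allFin n) (χ̄ K)))
              (∑-cong (allFin n) (λ x → χ̄-*-cong K x (λ q → cong (λ s → eq s (suc t) * atLeast K) (sym (∣∪′∣ K x q))))))))
          (∑-transfer F))
          where
          lem₃ : ∀ u e a → u * (e * a) ≡ e * (u * a)
          lem₃ = solve-∀
          lem₄ : ∀ e u a → e * (u * a) ≡ u * (e * a)
          lem₄ = solve-∀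

  -- Anticoncentration of the number of edges

  -- t! (n - t)! / n! is the probability that a random permutation starts with a given t-set.
  orders : ℕ → ℕ → ℕ
  orders n t = t ! * (n ∸ t) !

  ∸-suc : ∀ {n t} → t < n → n ∸ t ≡ suc (n ∸ suc t)
  ∸-suc t<n = +-∸-assoc 1 t<n

  nCk*orders≡n! : ∀ {n k} → k ≤ n → (n C k) * orders n k ≡ n !
  nCk*orders≡n! {n} {k} k≤n = trans (cong (_* orders n k) (nCk≡n!/k![n-k]! k≤n)) (m/n*n≡m {{k !* (n ∸ k) !≢0}} (k![n∸k]!∣n! k≤n))

  module Anticoncentration {n : ℕ} (G : Hypergraph n) (r : ℕ) (rank : RankAtMost r G) (ℓ : ℕ) where

    open EdgeCount G r rank public

    module _ (m N : ℕ) (2N≤n : 2 * N ≤ n) where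

      -- This is n! times the probability h(t) of the overview.
      mass : ℕ → ℕ
      mass t = members ℓ m t * orders n t

      -- `D` counts the isolated vertices. `β D` is n! times the probability that the first m + D
      -- vertices form a member and the next one is blocked, so that β / H is the conditional
      -- probability.
      H β : ℕ → ℕ
      H D = mass (m + D)
      β D = blockings ℓ m (m + D) * ((m + D) ! * (n ∸ suc (m + D)) !)

      N≤n : N ≤ n
      N≤n = ≤-trans (m≤m+n N _) 2N≤n

      balance : ∀ D → m + D < N → suc (m + D) * H D ≡ suc D * H (suc D) + suc (m + D) * β D
      balance D t<N rewrite +-suc m D | ∸-suc (≤-trans t<N N≤n) = begin
        suc t * (g₀ * (f * (suc u * v)))
          ≡⟨ lem₁ (suc t) g₀ f (suc u) v ⟩
        suc t * (f * v) * (suc u * g₀)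
          ≡⟨ cong (suc t * (f * v) *_) (sym (extensions+blockings ℓ m t (suc u) (trans (+-suc t u) (m+[n∸m]≡n (≤-trans t<N N≤n))))) ⟩
        suc t * (f * v) * (extensions ℓ m t + b₀)
          ≡⟨ cong (λ s → suc t * (f * v) * (s + b₀)) (extensions≡ ℓ m t (suc D) (cong suc (+-comm D m))) ⟩
        suc t * (f * v) * (suc D * g₁ + b₀)
          ≡⟨ lem₂ (suc t) f v (suc D) g₁ b₀ ⟩
        suc D * (g₁ * (suc t * f * v)) + suc t * (b₀ * (f * v)) ∎
        where
        open ≡-Reasoning
        t = m + D
        u = n ∸ suc t
        f = t !
        v = u !
        g₀ = members ℓ m t
        g₁ = members ℓ m (suc t)
        b₀ = blockings ℓ m t
        lem₁ : ∀ t g f u v → t * (g * (f * (u * v))) ≡ t * (f * v) * (u * g)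
        lem₁ = solve-∀
        lem₂ : ∀ t f v d g b → t * (f * v) * (d * g + b) ≡ d * (g * (t * f * v)) + t * (b * (f * v))
        lem₂ = solve-∀

      -- The rate divides the blocked vertices by the n - t remaining ones, and the passage to n - t
      -- - 1 costs a factor 1 + 1 / (n - t - 1). As `2N≤n` gives D + 1 ≤ n - t, replacing `r` by
      -- `suc r` absorbs this.
      growth : ∀ D → m + suc D < N →
        suc D * (β (suc D) * H D) ≤ suc D * (β D * H (suc D)) + suc r * (β (suc D) * H D)
      growth D t<N rewrite +-suc m D | ∸-suc (≤-trans (<⇒≤ t<N) N≤n) | ∸-suc (≤-trans t<N N≤n) = begin
        suc D * (b₁ * (suc t * f * y) * (g₀ * (f * (suc (suc v) * (suc v * y)))))
          ≡⟨ lem₁ (suc D) b₁ (suc t) f y g₀ (suc v) ⟩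
        X * (suc v * (suc D * a) + suc D * a)
          ≤⟨ *-monoʳ-≤ X (+-mono-≤ (*-monoʳ-≤ (suc v) (blockings-growth ℓ m t (suc D) (suc v) (cong suc (+-comm D m))
               (trans (+-suc (suc t) v) (m+[n∸m]≡n (≤-trans t<N N≤n))))) (*-monoˡ-≤ a D≤v)) ⟩
        X * (suc v * (suc D * c + r * a) + suc (suc v) * a)
          ≤⟨ *-monoʳ-≤ X (m≤m+n _ (r * a)) ⟩
        X * (suc v * (suc D * c + r * a) + suc (suc v) * a + r * a)
          ≡⟨ lem₂ (suc D) b₀ b₁ (suc t) f y g₀ g₁ r v ⟩
        suc D * (b₀ * (f * (suc v * y)) * (g₁ * (suc t * f * (suc v * y)))) +
        suc r * (b₁ * (suc t * f * y) * (g₀ * (f * (suc (suc v) * (suc v * y))))) ∎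
        where
        open ≤-Reasoning
        t = m + D
        v = n ∸ suc (suc t)
        f = t !
        y = v !
        g₀ = members ℓ m t
        g₁ = members ℓ m (suc t)
        b₀ = blockings ℓ m t
        b₁ = blockings ℓ m (suc t)
        a = b₁ * g₀
        c = b₀ * g₁
        X = f * (suc t * f) * y * (suc v * y)
        D≤v : suc D ≤ suc (suc v)
        D≤v = +-cancelʳ-≤ t _ _ (≤-trans (+-mono-≤ (≤-trans (s≤s (m≤n+m D m)) (<⇒≤ t<N)) (≤-trans (n≤1+n t) (<⇒≤ t<N)))
          (≤-trans (≤-reflexive (cong (N +_) (sym (+-identityʳ N)))) (≤-trans 2N≤n
            (≤-reflexive (trans (sym (m+[n∸m]≡n (≤-trans t<N N≤n))) (lem t v))))))
          where
          lem : ∀ t v → suc (suc t) + v ≡ suc (suc v) + t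
          lem = solve-∀
        lem₁ : ∀ d b t f y g v → d * (b * (t * f * y) * (g * (f * (suc v * (v * y))))) ≡
          f * (t * f) * y * (v * y) * (v * (d * (b * g)) + d * (b * g))
        lem₁ = solve-∀
        lem₂ : ∀ d b₀ b₁ t f y g₀ g₁ r v →
          f * (t * f) * y * (suc v * y) * (suc v * (d * (b₀ * g₁) + r * (b₁ * g₀)) + suc (suc v) * (b₁ * g₀) + r * (b₁ * g₀)) ≡
          d * (b₀ * (f * (suc v * y)) * (g₁ * (t * f * (suc v * y)))) +
          suc r * (b₁ * (t * f * y) * (g₀ * (f * (suc (suc v) * (suc v * y)))))
        lem₂ = solve-∀

      open Window H β m (suc r) N balance growth

      -- On one side of m + d there are `J` sizes, all below `N`, whose mass is at least half of
      -- that at m + d.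
      mass≤∑ : ∀ d J → 0 < J → 8 * (J * J * m * suc (suc r)) ≤ d * d → 2 * J ≤ d → 2 * (J * suc r) ≤ d → m + d + J < N →
        J * mass (m + d) ≤ 2 * ∑ (downFrom N) mass
      mass≤∑ d J 0<J J-small 2J≤d 2JR≤d bound = subst (J * mass (m + d) ≤_) (∑-*ˡ 2 (downFrom N) mass)
        (from (window d J 0<J J-small 2J≤d 2JR≤d bound))
        where
        J≤d : J ≤ d
        J≤d = ≤-trans (m≤m+n J _) 2J≤d
        from : (∀ j → j ≤ J → H d ≤ 2 * H (d + j)) ⊎ (∀ j → j ≤ J → H d ≤ 2 * H (d ∸ j)) →
          J * mass (m + d) ≤ ∑ (downFrom N) (λ t → 2 * mass t)
        from (inj₁ up) = ≤-trans
          (∑-downFrom-window (m + d) J (mass (m + d)) (λ t → 2 * mass t)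
            (λ i i<J → subst (λ s → mass (m + d) ≤ 2 * mass s) (sym (+-assoc m d i)) (up i (<⇒≤ i<J))))
          (∑-downFrom-mono (λ t → 2 * mass t) (<⇒≤ bound))
        from (inj₂ down) = ≤-trans
          (∑-downFrom-window (m + (d ∸ J)) J (mass (m + d)) (λ t → 2 * mass t)
            (λ i i<J → subst (λ s → mass (m + d) ≤ 2 * mass s) (index i (<⇒≤ i<J)) (down (J ∸ i) (m∸n≤m J i))))
          (∑-downFrom-mono (λ t → 2 * mass t) (≤-trans (≤-reflexive (trans (+-assoc m (d ∸ J) J) (cong (m +_) (m∸n+n≡m J≤d))))
            (≤-trans (m≤m+n (m + d) J) (<⇒≤ bound))))
          where
          index : ∀ i → i ≤ J → m + (d ∸ (J ∸ i)) ≡ m + (d ∸ J) + i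
          index i i≤J = trans (cong (m +_) (trans (cong (_∸ (J ∸ i)) (sym split)) (m+n∸n≡m (d ∸ J + i) (J ∸ i))))
            (sym (+-assoc m (d ∸ J) i))
            where
            split : d ∸ J + i + (J ∸ i) ≡ d
            split = trans (+-assoc (d ∸ J) i (J ∸ i)) (trans (cong (d ∸ J +_) (m+[n∸m]≡n i≤J)) (m∸n+n≡m J≤d))

    core≤size : ∀ A → core A ≤ ∣ A ∣
    core≤size A = ≤-trans (∑-mono (allFin n) present) (≤-reflexive (sym (∣p∣≡∑χ A)))
      where
      present : ∀ x → pos (deg A x) ≤ χ A x
      present x with lookup A x in eqx
      ... | true  = pos≤1 (deg A x)
      ... | false rewrite deg-absent A x eqx = z≤n

    core≤n : ∀ A → core A ≤ n
    core≤n A = ≤-trans (core≤size A) (∣p∣≤n A)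

    exact : ℕ → ℕ
    exact t = ∑ (allSubsets n) (λ A → eq ∣ A ∣ t * eq (edges A) ℓ)

    -- A set with `ℓ` edges is a member for just one `m`, its core size. Taking f = 1 gives `exact`,
    -- and f = `id` gives `coreMass`.
    ∑-members : ∀ (f : ℕ → ℕ) t → ∑ (downFrom (suc n)) (λ m → f m * members ℓ m t) ≡
      ∑ (allSubsets n) (λ A → eq ∣ A ∣ t * (eq (edges A) ℓ * f (core A)))
    ∑-members f t = trans (∑-cong (downFrom (suc n)) (λ m → sym (∑-*ˡ (f m) (allSubsets n) _)))
      (trans (∑-comm (downFrom (suc n)) (allSubsets n) _) (∑-cong (allSubsets n) (λ A →
        trans (∑-cong (downFrom (suc n)) (λ m → lem (f m) (eq ∣ A ∣ t) (eq (edges A) ℓ) (eq (core A) m)))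
          (trans (∑-*ˡ (eq ∣ A ∣ t) (downFrom (suc n)) _) (cong (eq ∣ A ∣ t *_)
            (trans (∑-*ˡ (eq (edges A) ℓ) (downFrom (suc n)) _) (cong (eq (edges A) ℓ *_)
              (∑-downFrom-eq (suc n) (core A) f (s≤s (core≤n A))))))))))
      where
      lem : ∀ f a b c → f * (a * (b * c)) ≡ a * (b * (c * f))
      lem = solve-∀

    coreMass-0 : coreMass ℓ 0 ≡ 0
    coreMass-0 = trans (∑-cong (allSubsets n) (λ A → trans (eq-*-cong {∣ A ∣} {0} (λ p →
      trans (cong (eq (edges A) ℓ *_) (n≤0⇒n≡0 (≤-trans (core≤size A) (≤-reflexive p)))) (*-zeroʳ (eq (edges A) ℓ)))) (*-zeroʳ (eq ∣ A ∣ 0))))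
      (∑-zero (allSubsets n))

    -- `above-step` telescopes: n! times the probability of at least `ℓ` edges rises at time t by at
    -- least `coreMass` times `orders` divided by t, and 1 / t ≥ 1 / L.
    ∑-coreMass≤ : ∀ L t → t ≤ L → t ≤ n →
      ∑ (downFrom (suc t)) (λ s → coreMass ℓ s * orders n s) ≤ L * (above ℓ t * orders n t)
    ∑-coreMass≤ L zero _ _ = subst (λ s → s * orders n 0 + 0 ≤ L * (above ℓ 0 * orders n 0)) (sym coreMass-0) z≤n
    ∑-coreMass≤ L (suc t) t<L t<n = ≤-trans
      (+-monoʳ-≤ (coreMass ℓ (suc t) * orders n (suc t)) (∑-coreMass≤ L t (<⇒≤ t<L) (<⇒≤ t<n)))
      (subst (λ s → coreMass ℓ (suc t) * orders n (suc t) + L * (above ℓ t * (t ! * s !)) ≤ L * (above ℓ (suc t) * orders n (suc t)))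
        (sym (∸-suc t<n)) (begin
      c * (suc t * f * v) + L * (above ℓ t * (f * (suc u * v)))
        ≡⟨ lem₁ c (suc t) f v L (above ℓ t) (suc u) ⟩
      (f * v) * (suc t * c + L * (suc u * above ℓ t))
        ≤⟨ *-monoʳ-≤ (f * v) (+-monoˡ-≤ _ (*-monoˡ-≤ c t<L)) ⟩
      (f * v) * (L * c + L * (suc u * above ℓ t))
        ≡⟨ cong (f * v *_) (sym (*-distribˡ-+ L c _)) ⟩
      (f * v) * (L * (c + suc u * above ℓ t))
        ≤⟨ *-monoʳ-≤ (f * v) (*-monoʳ-≤ L (above-step ℓ t (suc u) (trans (+-suc t u) (m+[n∸m]≡n t<n)))) ⟩
      (f * v) * (L * (suc t * above ℓ (suc t)))
        ≡⟨ lem₂ f v L (suc t) (above ℓ (suc t)) ⟩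
      L * (above ℓ (suc t) * (suc t * f * v)) ∎))
      where
      open ≤-Reasoning
      c = coreMass ℓ (suc t)
      u = n ∸ suc t
      f = t !
      v = u !
      lem₁ : ∀ c t f v L a u → c * (t * f * v) + L * (a * (f * (u * v))) ≡ f * v * (t * c + L * (u * a))
      lem₁ = solve-∀
      lem₂ : ∀ f v L t a → f * v * (L * (t * a)) ≡ L * (a * (t * f * v))
      lem₂ = solve-∀

    above≤ : ∀ t → t ≤ n → above ℓ t * orders n t ≤ n !
    above≤ t t≤n = ≤-trans (*-monoˡ-≤ (orders n t) (≤-trans
      (∑-mono (allSubsets n) (λ A → ≤-trans (*-monoʳ-≤ (eq ∣ A ∣ t) (pos≤1 _)) (≤-reflexive (*-identityʳ _))))
      (≤-reflexive (∑-size n t)))) (≤-reflexive (nCk*orders≡n! t≤n))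

    exact≤ : ∀ t → exact t ≤ n C t
    exact≤ t = ≤-trans (∑-mono (allSubsets n) (λ A → ≤-trans (*-monoʳ-≤ (eq ∣ A ∣ t) (eq≤1 (edges A) ℓ)) (≤-reflexive (*-identityʳ _))))
      (≤-reflexive (∑-size n t))
      where
      eq≤1 : ∀ a b → eq a b ≤ 1
      eq≤1 a b with a ≡ᵇ b
      ... | true  = ≤-refl
      ... | false = z≤n

    exact-count : ∀ k → length (filter (λ S → edgesIn G S ≟ ℓ) (kSubsets n k)) ≡ exact k
    exact-count k = trans (length-filter (λ S → edgesIn G S ≟ ℓ) (kSubsets n k))
      (trans (∑-filter (λ S → ∣ S ∣ ≟ k) (allSubsets n) _)
        (∑-cong (allSubsets n) (λ A → cong (λ e → eq ∣ A ∣ k * eq e ℓ) (edgesIn≡edges A))))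

    anticoncentration : ∀ k z → 0 < k → 4 * k + 2 ≤ n →
      (∀ A → ∣ A ∣ ≡ k → edges A ≡ ℓ → ∃[ d ] ∃[ J ] (core A + d ≡ k × 0 < J × k * z ≤ 8 * core A * J ×
        8 * (J * J * core A * suc (suc r)) ≤ d * d × 2 * J ≤ d × 2 * (J * suc r) ≤ d)) →
      z * exact k ≤ 32 * (n C k)
    anticoncentration k z 0<k 4k+2≤n params = *-cancelʳ-≤ (z * exact k) (32 * (n C k)) (k * orders n k)
      {{m*n≢0 k (orders n k) {{>-nonZero 0<k}} {{k !* (n ∸ k) !≢0}}}} (begin
      z * exact k * (k * orders n k)
        ≡⟨ lem₁ z (exact k) k (orders n k) ⟩
      exact k * (k * z * orders n k)
        ≡⟨ cong (_* (k * z * orders n k)) (sym (trans (∑-members (λ _ → 1) k)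
             (∑-cong (allSubsets n) (λ A → cong (eq ∣ A ∣ k *_) (*-identityʳ (eq (edges A) ℓ)))))) ⟩
      ∑ (downFrom (suc n)) (λ m → 1 * members ℓ m k) * (k * z * orders n k)
        ≡⟨ sym (∑-*ʳ (k * z * orders n k) (downFrom (suc n)) (λ m → 1 * members ℓ m k)) ⟩
      ∑ (downFrom (suc n)) (λ m → 1 * members ℓ m k * (k * z * orders n k))
        ≤⟨ ∑-mono (downFrom (suc n)) (λ m → ≤-trans (≤-reflexive (lem₂ (members ℓ m k) k z (orders n k))) (each m)) ⟩
      ∑ (downFrom (suc n)) (λ m → 16 * (m * ∑ (downFrom N) (λ t → members ℓ m t * orders n t)))
        ≡⟨ trans (∑-*ˡ 16 (downFrom (suc n)) (λ m → m * ∑ (downFrom N) (λ t → members ℓ m t * orders n t))) (cong (16 *_) regroup) ⟩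
      16 * ∑ (downFrom N) (λ t → coreMass ℓ t * orders n t)
        ≤⟨ *-monoʳ-≤ 16 (≤-trans (∑-coreMass≤ (2 * k) (2 * k) ≤-refl 2k≤n) (*-monoʳ-≤ (2 * k) (above≤ (2 * k) 2k≤n))) ⟩
      16 * (2 * k * n !)
        ≡⟨ cong (λ s → 16 * (2 * k * s)) (sym (nCk*orders≡n! k≤n)) ⟩
      16 * (2 * k * ((n C k) * orders n k))
        ≡⟨ lem₃ k (n C k) (orders n k) ⟩
      32 * (n C k) * (k * orders n k) ∎)
      where
      open ≤-Reasoning
      N = suc (2 * k)
      2N≤n : 2 * N ≤ n
      2N≤n = subst (_≤ n) (lem k) 4k+2≤n
        where
        lem : ∀ k → 4 * k + 2 ≡ 2 * suc (2 * k)
        lem = solve-∀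
      2k≤n : 2 * k ≤ n
      2k≤n = ≤-trans (n≤1+n _) (≤-trans (m≤m+n N _) 2N≤n)
      k≤n : k ≤ n
      k≤n = ≤-trans (m≤m+n k _) 2k≤n
      lem₁ : ∀ z e k o → z * e * (k * o) ≡ e * (k * z * o)
      lem₁ = solve-∀
      lem₂ : ∀ g k z o → 1 * g * (k * z * o) ≡ k * z * (g * o)
      lem₂ = solve-∀
      lem₃ : ∀ k c o → 16 * (2 * k * (c * o)) ≡ 32 * c * (k * o)
      lem₃ = solve-∀
      regroup : ∑ (downFrom (suc n)) (λ m → m * ∑ (downFrom N) (λ t → members ℓ m t * orders n t)) ≡
        ∑ (downFrom N) (λ t → coreMass ℓ t * orders n t)
      regroup = trans (∑-cong (downFrom (suc n)) (λ m → sym (∑-*ˡ m (downFrom N) _)))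
        (trans (∑-comm (downFrom (suc n)) (downFrom N) _) (∑-cong (downFrom N) (λ t →
          trans (∑-cong (downFrom (suc n)) (λ m → sym (*-assoc m (members ℓ m t) (orders n t))))
            (trans (∑-*ʳ (orders n t) (downFrom (suc n)) (λ m → m * members ℓ m t)) (cong (_* orders n t) (∑-members id t))))))
      each : ∀ m → k * z * (members ℓ m k * orders n k) ≤ 16 * (m * ∑ (downFrom N) (λ t → members ℓ m t * orders n t))
      each m with members ℓ m k in eqg
      ... | zero = ≤-trans (≤-reflexive (*-zeroʳ (k * z))) z≤n
      ... | suc _ with ∑-pos⇒∃ (allSubsets n) (subst (0 <_) (sym eqg) (s≤s z≤n))
      ... | A , 0<w with params A (eq-pos ∣ A ∣ k (proj₁ (*-pos (eq ∣ A ∣ k) _ 0<w)))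
                           (φ-edges ℓ m A (proj₂ (*-pos (eq ∣ A ∣ k) _ 0<w)))
                       | φ-core ℓ m A (proj₂ (*-pos (eq ∣ A ∣ k) _ 0<w))
      ... | d , J , core+d≡k , 0<J , kz≤ , J-small , 2J≤d , 2JR≤d | refl = subst
        (λ s → k * z * (s * orders n k) ≤ 16 * (m * S)) eqg (begin
        k * z * mass m N 2N≤n k         ≤⟨ *-monoˡ-≤ (mass m N 2N≤n k) kz≤ ⟩
        8 * m * J * mass m N 2N≤n k     ≡⟨ *-assoc (8 * m) J _ ⟩
        8 * m * (J * mass m N 2N≤n k)   ≤⟨ *-monoʳ-≤ (8 * m) (subst (λ s → J * mass m N 2N≤n s ≤ 2 * S) core+d≡k
                                            (mass≤∑ m N 2N≤n d J 0<J J-small 2J≤d 2JR≤d bound)) ⟩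
        8 * m * (2 * S)                 ≡⟨ lem₄ m S ⟩
        16 * (m * S)                    ∎)
        where
        S = ∑ (downFrom N) (λ t → members ℓ m t * orders n t)
        lem₄ : ∀ m s → 8 * m * (2 * s) ≡ 16 * (m * s)
        lem₄ = solve-∀
        bound : core A + d + J < N
        bound = s≤s (subst (λ s → s + J ≤ 2 * k) (sym core+d≡k) (≤-trans (+-monoʳ-≤ k (≤-trans (≤-trans (m≤m+n J _) 2J≤d)
          (≤-trans (m≤n+m d (core A)) (≤-reflexive core+d≡k)))) (≤-reflexive (cong (k +_) (sym (+-identityʳ k))))))

  -- Numerical estimates

  m*m≤n*n⇒m≤n : ∀ {a b} → a * a ≤ b * b → a ≤ b
  m*m≤n*n⇒m≤n {a} {b} p with a ≤? b
  ... | yes q = q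
  ... | no ¬q = contradiction (*-mono-< (≰⇒> ¬q) (≰⇒> ¬q)) (≤⇒≯ p)

  ^-distribʳ-* : ∀ r a b → (a * b) ^ r ≡ a ^ r * b ^ r
  ^-distribʳ-* zero    a b = refl
  ^-distribʳ-* (suc r) a b = trans (cong (a * b *_) (^-distribʳ-* r a b)) (lem a b (a ^ r) (b ^ r))
    where
    lem : ∀ a b c d → a * b * (c * d) ≡ a * c * (b * d)
    lem = solve-∀

  -- A factor 1 + 1 / q takes x ≤ q to at most x + 1, so `i` such factors take q - i to at most q.
  bernoulli : ∀ q i x → i + x ≡ q → suc q ^ i * x ≤ q ^ i * q
  bernoulli q zero    x refl = ≤-refl
  bernoulli q (suc i) x i+x≡ = begin
    suc q * suc q ^ i * x            ≡⟨ lem₁ q (suc q ^ i) x ⟩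
    suc q ^ i * (q * x + x)          ≤⟨ *-monoʳ-≤ (suc q ^ i) (+-monoʳ-≤ (q * x) (≤-trans (m≤n+m x (suc i)) (≤-reflexive i+x≡))) ⟩
    suc q ^ i * (q * x + q)          ≡⟨ lem₂ q (suc q ^ i) x ⟩
    suc q ^ i * suc x * q            ≤⟨ *-monoˡ-≤ q (bernoulli q i (suc x) (trans (+-suc i x) i+x≡)) ⟩
    q ^ i * q * q                    ≡⟨ cong (_* q) (*-comm (q ^ i) q) ⟩
    q * q ^ i * q                    ∎
    where
    open ≤-Reasoning
    lem₁ : ∀ q a x → suc q * a * x ≡ a * (q * x + x)
    lem₁ = solve-∀
    lem₂ : ∀ q a x → a * (q * x + q) ≡ a * suc x * q
    lem₂ = solve-∀

  -- The even exponent splits into two halves, each of which `bernoulli` bounds by 2.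
  [1+1/2j]^2j≤4 : ∀ j → 0 < j → suc (2 * j) ^ (2 * j) ≤ 4 * (2 * j) ^ (2 * j)
  [1+1/2j]^2j≤4 j@(suc _) _ = begin
    suc (2 * j) ^ (2 * j)                        ≡⟨ double (suc (2 * j)) ⟩
    suc (2 * j) ^ j * suc (2 * j) ^ j            ≤⟨ *-mono-≤ half half ⟩
    2 * (2 * j) ^ j * (2 * (2 * j) ^ j)          ≡⟨ lem ((2 * j) ^ j) ⟩
    4 * ((2 * j) ^ j * (2 * j) ^ j)              ≡⟨ cong (4 *_) (sym (double (2 * j))) ⟩
    4 * (2 * j) ^ (2 * j)                        ∎
    where
    open ≤-Reasoning
    lem : ∀ a → 2 * a * (2 * a) ≡ 4 * (a * a)
    lem = solve-∀
    lem′ : ∀ a j → a * (2 * j) ≡ 2 * a * j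
    lem′ = solve-∀
    double : ∀ a → a ^ (2 * j) ≡ a ^ j * a ^ j
    double a = trans (cong (λ s → a ^ (j + s)) (+-identityʳ j)) (^-distribˡ-+-* a j j)
    half : suc (2 * j) ^ j ≤ 2 * (2 * j) ^ j
    half = *-cancelʳ-≤ _ _ j (≤-trans (bernoulli (2 * j) j j (cong (j +_) (sym (+-identityʳ j))))
      (≤-reflexive (lem′ ((2 * j) ^ j) j)))

  -- With q = 2j the hypothesis reads ℓ ≤ q^r (1 + 1 / q)^c. For c ≤ qr the last factor is at most
  -- 4^r, which leaves (4q)^r. For j = z² the contrapositive says that many edges need a large core.
  few-edges : ∀ j r c ℓ → 0 < j → ℓ * (2 * j) ^ c ≤ (2 * j) ^ r * suc (2 * j) ^ c → c ≤ 2 * j * r → ℓ ≤ (8 * j) ^ r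
  few-edges j@(suc _) r c ℓ 0<j bound c≤ = *-cancelʳ-≤ ℓ _ (q ^ (q * r)) {{m^n≢0 q (q * r)}} (begin
    ℓ * q ^ (q * r)                          ≡⟨ cong (ℓ *_) (split q) ⟩
    ℓ * (q ^ c * q ^ e)                      ≡⟨ sym (*-assoc ℓ (q ^ c) (q ^ e)) ⟩
    ℓ * q ^ c * q ^ e                        ≤⟨ *-mono-≤ bound (^-monoˡ-≤ e (n≤1+n q)) ⟩
    q ^ r * suc q ^ c * suc q ^ e            ≡⟨ trans (*-assoc (q ^ r) _ _) (cong (q ^ r *_) (sym (split (suc q)))) ⟩
    q ^ r * suc q ^ (q * r)                  ≡⟨ cong (q ^ r *_) (sym (^-*-assoc (suc q) q r)) ⟩
    q ^ r * (suc q ^ q) ^ r                  ≤⟨ *-monoʳ-≤ (q ^ r) (^-monoˡ-≤ r ([1+1/2j]^2j≤4 j 0<j)) ⟩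
    q ^ r * (4 * q ^ q) ^ r                  ≡⟨ sym (^-distribʳ-* r q (4 * q ^ q)) ⟩
    (q * (4 * q ^ q)) ^ r                    ≡⟨ cong (_^ r) (lem j (q ^ q)) ⟩
    (8 * j * q ^ q) ^ r                      ≡⟨ ^-distribʳ-* r (8 * j) (q ^ q) ⟩
    (8 * j) ^ r * (q ^ q) ^ r                ≡⟨ cong ((8 * j) ^ r *_) (^-*-assoc q q r) ⟩
    (8 * j) ^ r * q ^ (q * r)                ∎)
    where
    open ≤-Reasoning
    q = 2 * j
    e = q * r ∸ c
    split : ∀ a → a ^ (q * r) ≡ a ^ c * a ^ e
    split a = trans (cong (a ^_) (sym (m+[n∸m]≡n c≤))) (^-distribˡ-+-* a c e)
    lem : ∀ j x → 2 * j * (4 * x) ≡ 8 * j * x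
    lem = solve-∀

  WindowLength : (r k z m d J : ℕ) → Set
  WindowLength r k z m d J = 0 < J × k * z ≤ 8 * m * J ×
    8 * (J * J * m * suc (suc r)) ≤ d * d × 2 * J ≤ d × 2 * (J * suc r) ≤ d

  -- As r + 2 ≤ 2r and r ≤ m, the single bound on 16rmJ² covers all three demands that relate `J` to
  -- `d`.
  windowLength : ∀ r k z m d J → 3 ≤ r → r ≤ m → 0 < J → k * z ≤ 8 * m * J → 16 * (r * m) * (J * J) ≤ d * d → WindowLength r k z m d J
  windowLength r k z m d J 3≤r r≤m 0<J kz≤ small = 0<J , kz≤ , c₁ , c₂ , c₃
    where
    open ≤-Reasoning
    r+2≤2r : suc (suc r) ≤ 2 * r
    r+2≤2r = ≤-trans (+-monoˡ-≤ r (<⇒≤ 3≤r)) (≤-reflexive (cong (r +_) (sym (+-identityʳ r))))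
    lem₁ : ∀ J m r → 8 * (J * J * m * (2 * r)) ≡ 16 * (r * m) * (J * J)
    lem₁ = solve-∀
    lem₂ : ∀ J r → 2 * (J * (2 * r)) * (2 * (J * (2 * r))) ≡ 16 * (r * r) * (J * J)
    lem₂ = solve-∀
    c₁ : 8 * (J * J * m * suc (suc r)) ≤ d * d
    c₁ = ≤-trans (*-monoʳ-≤ 8 (*-monoʳ-≤ (J * J * m) r+2≤2r)) (≤-trans (≤-reflexive (lem₁ J m r)) small)
    c₃ : 2 * (J * suc r) ≤ d
    c₃ = m*m≤n*n⇒m≤n (begin
      2 * (J * suc r) * (2 * (J * suc r))          ≤⟨ *-mono-≤ (*-monoʳ-≤ 2 (*-monoʳ-≤ J (<⇒≤ r+2≤2r))) (*-monoʳ-≤ 2 (*-monoʳ-≤ J (<⇒≤ r+2≤2r))) ⟩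
      2 * (J * (2 * r)) * (2 * (J * (2 * r)))      ≡⟨ lem₂ J r ⟩
      16 * (r * r) * (J * J)                       ≤⟨ *-monoˡ-≤ (J * J) (*-monoʳ-≤ 16 (*-monoʳ-≤ r r≤m)) ⟩
      16 * (r * m) * (J * J)                       ≤⟨ small ⟩
      d * d                                        ∎)
    c₂ : 2 * J ≤ d
    c₂ = ≤-trans (*-monoʳ-≤ 2 (≤-trans (≤-reflexive (sym (*-identityʳ J))) (*-monoʳ-≤ J (s≤s z≤n)))) c₃

  -- Here d ≥ k / 2, and `J` is the least integer above kz / (8m). The main part of J² is controlled
  -- by 2z²r ≤ m. Rounding costs (J₀ + 1)² ≤ (5/4)J₀² + 5, by `amgm J₀ 4`, and 512r ≤ k pays for the
  -- constant 5.
  sparse-window : ∀ r k z m d → 0 < m → m + d ≡ k → 2 * m ≤ k → 2 * (z * z) * r ≤ m → 512 * r ≤ k →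
    ∃[ J ] (0 < J × k * z ≤ 8 * m * J × 16 * (r * m) * (J * J) ≤ d * d)
  sparse-window r k z m@(suc _) d _ m+d≡k 2m≤k z-small k-large = suc J₀ , s≤s z≤n , <⇒≤ kz< , *-cancelˡ-≤ 32 (begin
    32 * (16 * (r * m) * (suc J₀ * suc J₀))
      ≡⟨ lem₁ (r * m) J₀ ⟩
    128 * (r * m) * (4 * (J₀ * J₀) + 2 * (J₀ * 4) + 4)
      ≤⟨ *-monoʳ-≤ (128 * (r * m)) (+-monoˡ-≤ 4 (+-monoʳ-≤ (4 * (J₀ * J₀)) (amgm J₀ 4))) ⟩
    128 * (r * m) * (4 * (J₀ * J₀) + (J₀ * J₀ + 16) + 4)
      ≡⟨ lem₂ r m J₀ ⟩
    5 * (128 * (r * m) * (J₀ * J₀)) + 1280 * r * (2 * m)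
      ≤⟨ +-mono-≤ (*-monoʳ-≤ 5 main) (*-mono-≤ 1280r≤3k 2m≤k) ⟩
    5 * (k * k) + 3 * k * k
      ≡⟨ lem₃ k ⟩
    8 * (k * k)
      ≤⟨ *-monoʳ-≤ 8 (*-mono-≤ k≤2d k≤2d) ⟩
    8 * (2 * d * (2 * d))
      ≡⟨ lem₄ d ⟩
    32 * (d * d) ∎)
    where
    open ≤-Reasoning
    J₀ = (k * z) / (8 * m)
    R₀ = (k * z) % (8 * m)
    lem₁ : ∀ a J → 32 * (16 * a * (suc J * suc J)) ≡ 128 * a * (4 * (J * J) + 2 * (J * 4) + 4)
    lem₁ = solve-∀
    lem₂ : ∀ r m J → 128 * (r * m) * (4 * (J * J) + (J * J + 16) + 4) ≡ 5 * (128 * (r * m) * (J * J)) + 1280 * r * (2 * m)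
    lem₂ = solve-∀
    lem₃ : ∀ k → 5 * (k * k) + 3 * k * k ≡ 8 * (k * k)
    lem₃ = solve-∀
    lem₄ : ∀ d → 8 * (2 * d * (2 * d)) ≡ 32 * (d * d)
    lem₄ = solve-∀
    lem₅ : ∀ m r J → m * (128 * (r * m) * (J * J)) ≡ J * (8 * m) * (J * (8 * m)) * (2 * r)
    lem₅ = solve-∀
    lem₆ : ∀ k z r → k * z * (k * z) * (2 * r) ≡ 2 * (z * z) * r * (k * k)
    lem₆ = solve-∀
    kz< : k * z < 8 * m * suc J₀
    kz< = begin-strict
      k * z                      ≡⟨ m≡m%n+[m/n]*n (k * z) (8 * m) ⟩
      R₀ + J₀ * (8 * m)          <⟨ +-monoˡ-< (J₀ * (8 * m)) (m%n<n (k * z) (8 * m)) ⟩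
      8 * m + J₀ * (8 * m)       ≡⟨ *-comm (suc J₀) (8 * m) ⟩
      8 * m * suc J₀             ∎
    J₀≤ : J₀ * (8 * m) ≤ k * z
    J₀≤ = ≤-trans (m≤n+m _ R₀) (≤-reflexive (sym (m≡m%n+[m/n]*n (k * z) (8 * m))))
    main : 128 * (r * m) * (J₀ * J₀) ≤ k * k
    main = *-cancelˡ-≤ m (begin
      m * (128 * (r * m) * (J₀ * J₀))                       ≡⟨ lem₅ m r J₀ ⟩
      J₀ * (8 * m) * (J₀ * (8 * m)) * (2 * r)               ≤⟨ *-monoˡ-≤ (2 * r) (*-mono-≤ J₀≤ J₀≤) ⟩
      k * z * (k * z) * (2 * r)                             ≡⟨ lem₆ k z r ⟩
      2 * (z * z) * r * (k * k)                             ≤⟨ *-monoˡ-≤ (k * k) z-small ⟩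
      m * (k * k)                                           ∎)
    1280r≤3k : 1280 * r ≤ 3 * k
    1280r≤3k = ≤-trans (≤-trans (*-monoˡ-≤ r {1280} {3 * 512} (m≤m+n 1280 256)) (≤-reflexive (*-assoc 3 512 r))) (*-monoʳ-≤ 3 k-large)
    k≤2d : k ≤ 2 * d
    k≤2d = +-cancelˡ-≤ k _ _ (begin
      k + k              ≡⟨ cong₂ _+_ (sym m+d≡k) (sym m+d≡k) ⟩
      m + d + (m + d)    ≡⟨ lem₇ m d ⟩
      2 * m + 2 * d      ≤⟨ +-monoˡ-≤ (2 * d) 2m≤k ⟩
      k + 2 * d          ∎)
      where
      lem₇ : ∀ m d → m + d + (m + d) ≡ 2 * m + 2 * d
      lem₇ = solve-∀

  -- If m > k / 2, then `d` may be as small as k / q, but J = z already satisfies kz ≤ 8mJ, and so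
  -- short a window fits because z² is small compared with `k`.
  exists-window : ∀ r q k z m d → 3 ≤ r → 0 < z → 0 < q → m + d ≡ k → k ≤ q * d → 2 * (z * z) * r ≤ m →
    16 * r * (q * q) * (z * z) ≤ k → 512 * r ≤ k → ∃[ J ] WindowLength r k z m d J
  exists-window r@(suc _) q@(suc _) k z@(suc _) m d 3≤r _ _ m+d≡k k≤qd z-small kz-large k-large with 2 * m ≤? k
  ... | yes 2m≤k with sparse-window r k z m d 0<m m+d≡k 2m≤k z-small k-large
    where
    0<m : 0 < m
    0<m = ≤-trans (s≤s z≤n) z-small
  ...   | J , 0<J , kz≤ , small = J , windowLength r k z m d J 3≤r r≤m 0<J kz≤ small
    where
    r≤m : r ≤ m
    r≤m = ≤-trans (m≤n*m r (2 * (z * z))) z-small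
  exists-window r@(suc _) q@(suc _) k z@(suc _) m d 3≤r _ _ m+d≡k k≤qd z-small kz-large k-large | no 2m≰k =
    z , windowLength r k z m d z 3≤r r≤m (s≤s z≤n)
      (*-monoˡ-≤ z (≤-trans (<⇒≤ (≰⇒> 2m≰k)) (*-monoˡ-≤ m {2} {8} (s≤s (s≤s z≤n)))))
      (*-cancelˡ-≤ (q * q) (begin
        q * q * (16 * (r * m) * (z * z))      ≡⟨ lem₁ q r m z ⟩
        16 * r * (q * q) * (z * z) * m        ≤⟨ *-mono-≤ kz-large (≤-trans (m≤m+n m d) (≤-reflexive m+d≡k)) ⟩
        k * k                                 ≤⟨ *-mono-≤ k≤qd k≤qd ⟩
        q * d * (q * d)                       ≡⟨ lem₂ q d ⟩
        q * q * (d * d)                       ∎))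
    where
    open ≤-Reasoning
    r≤m : r ≤ m
    r≤m = ≤-trans (m≤n*m r (2 * (z * z))) z-small
    lem₁ : ∀ q r m z → q * q * (16 * (r * m) * (z * z)) ≡ 16 * r * (q * q) * (z * z) * m
    lem₁ = solve-∀
    lem₂ : ∀ q d → q * d * (q * d) ≡ q * q * (d * d)
    lem₂ = solve-∀

  -- `a` will be 16rq², fixed while `k` grows. If z² is at least `a`, then az² ≤ (8z²)² ≤ (8z²)^r ≤
  -- k; otherwise az² ≤ a² ≤ k.
  z²-small : ∀ r a z k → 3 ≤ r → (8 * (z * z)) ^ r ≤ k → a * a ≤ k → a * (z * z) ≤ k
  z²-small r a zero k _ _ _ = subst (_≤ k) (sym (*-zeroʳ a)) z≤n
  z²-small r a z@(suc _) k 3≤r zr≤k a²≤k with ≤-total a (z * z)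
  ... | inj₂ z²≤a = ≤-trans (*-monoʳ-≤ a z²≤a) a²≤k
  ... | inj₁ a≤z² = begin
    a * (z * z)                                       ≤⟨ *-mono-≤ (≤-trans a≤z² (m≤n*m (z * z) 8)) (m≤n*m (z * z) 8) ⟩
    8 * (z * z) * (8 * (z * z))                       ≡⟨ cong (8 * (z * z) *_) (sym (*-identityʳ (8 * (z * z)))) ⟩
    (8 * (z * z)) ^ 2                                 ≤⟨ ^-monoʳ-≤ (8 * (z * z)) (<⇒≤ 3≤r) ⟩
    (8 * (z * z)) ^ r                                 ≤⟨ zr≤k ⟩
    k                                                 ∎
    where open ≤-Reasoning

  bracket : ∀ (F : ℕ → ℕ) ℓ N → F 0 < ℓ → ℓ ≤ F N → ∃[ z ] (F z < ℓ × ℓ ≤ F (suc z))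
  bracket F ℓ zero    lo hi = contradiction lo (≤⇒≯ hi)
  bracket F ℓ (suc N) lo hi with ℓ ≤? F N
  ... | yes p = bracket F ℓ N lo p
  ... | no ¬p = N , ≰⇒> ¬p , hi

  -- With z ≈ ℓ^(1/2r) / √8, the target 100 ℓ^(-1/2r) is at least 100 / (3 (z + 1)).
  root-bracket : ∀ r ℓ → 0 < r → 0 < ℓ → ∃[ z ] ((8 * (z * z)) ^ r < ℓ × ℓ ≤ (8 * (suc z * suc z)) ^ r)
  root-bracket r@(suc _) ℓ@(suc _) _ _ = bracket (λ z → (8 * (z * z)) ^ r) ℓ ℓ (s≤s z≤n) (begin
    ℓ                      ≤⟨ m≤m*n ℓ ℓ ⟩
    ℓ * ℓ                  ≤⟨ m≤n*m (ℓ * ℓ) 8 ⟩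
    8 * (ℓ * ℓ)            ≡⟨ sym (^-identityʳ (8 * (ℓ * ℓ))) ⟩
    (8 * (ℓ * ℓ)) ^ 1      ≤⟨ ^-monoʳ-≤ (8 * (ℓ * ℓ)) {1} {r} (s≤s z≤n) ⟩
    (8 * (ℓ * ℓ)) ^ r      ∎)
    where open ≤-Reasoning

-- Passage to rational numbers

open Counting using (few-edges; exists-window; z²-small; root-bracket; module Anticoncentration)
open import Data.Integer as ℤ using (+_; -[1+_])
import Data.Integer.Properties as ℤ
import Data.Integer.Tactic.RingSolver as ℤ-Solver
open import Data.Rational using (ℚ; 0ℚ; 1ℚ; _<_; _-_; _*_; _+_; _/_; -_; mkℚ; toℚᵘ; fromℚᵘ; nonNegative; *<*) renaming (_≤_ to _≤ℚ_)
import Data.Rational.Properties as ℚ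
open import Data.Rational.Unnormalised as ℚᵘ using (mkℚᵘ; *≤*; *≡*)
import Data.Rational.Unnormalised.Properties as ℚᵘ

fromℚᵘ-homo-* : ∀ p q → fromℚᵘ p * fromℚᵘ q ≡ fromℚᵘ (p ℚᵘ.* q)
fromℚᵘ-homo-* p q = ℚ.toℚᵘ-injective (ℚᵘ.≃-trans (ℚ.toℚᵘ-homo-* (fromℚᵘ p) (fromℚᵘ q))
  (ℚᵘ.≃-trans (ℚᵘ.*-cong (ℚ.toℚᵘ-fromℚᵘ p) (ℚ.toℚᵘ-fromℚᵘ q)) (ℚᵘ.≃-sym (ℚ.toℚᵘ-fromℚᵘ (p ℚᵘ.* q)))))

fromℚᵘ-mono-≤ : ∀ {p q} → p ℚᵘ.≤ q → fromℚᵘ p ≤ℚ fromℚᵘ q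
fromℚᵘ-mono-≤ {p} {q} p≤q = ℚ.toℚᵘ-cancel-≤ (ℚᵘ.≤-respˡ-≃ (ℚᵘ.≃-sym (ℚ.toℚᵘ-fromℚᵘ p))
  (ℚᵘ.≤-respʳ-≃ (ℚᵘ.≃-sym (ℚ.toℚᵘ-fromℚᵘ q)) p≤q))

frac-≤ : ∀ a b c d → a ℕ.* suc d ≤ c ℕ.* suc b → (+ a) / suc b ≤ℚ (+ c) / suc d
frac-≤ a b c d p = fromℚᵘ-mono-≤ {mkℚᵘ (+ a) b} {mkℚᵘ (+ c) d}
  (*≤* (subst₂ ℤ._≤_ (ℤ.pos-* a (suc d)) (ℤ.pos-* c (suc b)) (ℤ.+≤+ p)))

ι-mono : ∀ {a b} → a ≤ b → ι a ≤ℚ ι b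
ι-mono {a} {b} p = frac-≤ a 0 b 0 (ℕ.*-monoˡ-≤ 1 p)

ι-homo-* : ∀ a b → ι a * ι b ≡ ι (a ℕ.* b)
ι-homo-* a b = trans (fromℚᵘ-homo-* (mkℚᵘ (+ a) 0) (mkℚᵘ (+ b) 0)) (cong (λ i → i / 1) (sym (ℤ.pos-* a b)))

ι-homo-^ : ∀ a e → ι a ^ℚ e ≡ ι (a ℕ.^ e)
ι-homo-^ a zero    = refl
ι-homo-^ a (suc e) = trans (cong (ι a *_) (ι-homo-^ a e)) (ι-homo-* a (a ℕ.^ e))

^-distrib-* : ∀ x y e → (x * y) ^ℚ e ≡ x ^ℚ e * y ^ℚ e
^-distrib-* x y zero    = refl
^-distrib-* x y (suc e) = trans (cong (x * y *_) (^-distrib-* x y e))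
  (trans (ℚ.*-assoc x y _) (trans (cong (x *_) (trans (sym (ℚ.*-assoc y _ _))
    (trans (cong (_* (y ^ℚ e)) (ℚ.*-comm y (x ^ℚ e))) (ℚ.*-assoc (x ^ℚ e) y _)))) (sym (ℚ.*-assoc x (x ^ℚ e) _))))

0≤^ : ∀ x e → 0ℚ ≤ℚ x → 0ℚ ≤ℚ x ^ℚ e
0≤^ x zero    p = ι-mono {0} {1} z≤n
0≤^ x (suc e) p = subst (_≤ℚ x * (x ^ℚ e)) (ℚ.*-zeroʳ x) (ℚ.*-monoˡ-≤-nonNeg x {{nonNegative p}} (0≤^ x e p))

frac-*-cancel : ∀ a b → ((+ a) / suc b) * ι (suc b) ≡ ι a
frac-*-cancel a b = trans (fromℚᵘ-homo-* (mkℚᵘ (+ a) b) (mkℚᵘ (+ suc b) 0))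
  (ℚ.fromℚᵘ-cong {mkℚᵘ (+ a) b ℚᵘ.* mkℚᵘ (+ suc b) 0} {mkℚᵘ (+ a) 0} (*≡* (lem (+ a) (+ suc b) (cong +_ (sym (ℕ.*-identityʳ (suc b)))))))
  where
  lem : ∀ i j {k} → j ≡ k → i ℤ.* j ℤ.* + 1 ≡ i ℤ.* k
  lem i j refl = ℤ.*-identityʳ (i ℤ.* j)

belowBound : ∀ r ℓ b → ℓ ≤ suc b ℕ.^ (2 ℕ.* r) → BelowBound r ℓ ((+ 100) / suc b)
belowBound r ℓ b ℓ≤ = 0≤x , (begin
  x ^ℚ (2 ℕ.* r) * ι ℓ                          ≤⟨ ℚ.*-monoˡ-≤-nonNeg (x ^ℚ (2 ℕ.* r)) {{nonNegative (0≤^ x (2 ℕ.* r) 0≤x)}} (ι-mono ℓ≤) ⟩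
  x ^ℚ (2 ℕ.* r) * ι (suc b ℕ.^ (2 ℕ.* r))      ≡⟨ cong (x ^ℚ (2 ℕ.* r) *_) (sym (ι-homo-^ (suc b) (2 ℕ.* r))) ⟩
  x ^ℚ (2 ℕ.* r) * ι (suc b) ^ℚ (2 ℕ.* r)        ≡⟨ sym (^-distrib-* x (ι (suc b)) (2 ℕ.* r)) ⟩
  (x * ι (suc b)) ^ℚ (2 ℕ.* r)                  ≡⟨ cong (_^ℚ (2 ℕ.* r)) (frac-*-cancel 100 b) ⟩
  ι 100 ^ℚ (2 ℕ.* r)                            ∎)
  where
  open ℚ.≤-Reasoning
  x = (+ 100) / suc b
  0≤x : 0ℚ ≤ℚ x
  0≤x = frac-≤ 0 0 100 b z≤n

ratio≤ : ∀ a d c b → a ℕ.* suc b ≤ c ℕ.* d → ratio a d ≤ℚ (+ c) / suc b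
ratio≤ a zero    c b p = frac-≤ 0 0 c b z≤n
ratio≤ a (suc d) c b p = frac-≤ a d c b p

p≤p+δ : ∀ p {δ} → 0ℚ < δ → p ≤ℚ p + δ
p≤p+δ p 0<δ = subst (_≤ℚ p + _) (ℚ.+-identityʳ p) (ℚ.+-monoʳ-≤ p (ℚ.<⇒≤ 0<δ))

-- For ε = p / q the hypothesis becomes qrℓ + pk ≤ qk. Only p ≥ 1 is kept, which in effect lowers ε
-- to 1 / q.
clear-denominator : ∀ ε → 0ℚ < ε → ∃[ q ] (0 ℕ.< q × (∀ k ℓ r → ι ℓ * ι r ≤ℚ (1ℚ - ε) * ι k →
  q ℕ.* (r ℕ.* ℓ) ℕ.+ k ≤ q ℕ.* k))
clear-denominator (mkℚ (+ zero) _ _) (*<* (ℤ.+<+ ()))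
clear-denominator (mkℚ -[1+ _ ] _ _) (*<* ())
clear-denominator ε@(mkℚ (+ suc p) q-1 _) 0<ε = suc q-1 , s≤s z≤n , bound
  where
  q = suc q-1
  bound : ∀ k ℓ r → ι ℓ * ι r ≤ℚ (1ℚ - ε) * ι k → q ℕ.* (r ℕ.* ℓ) ℕ.+ k ≤ q ℕ.* k
  bound k ℓ r h = ℕ.≤-trans (ℕ.+-monoʳ-≤ (q ℕ.* (r ℕ.* ℓ)) (ℕ.m≤n*m k (suc p))) (ℤ.drop‿+≤+ (subst₂ ℤ._≤_ left right
    (ℤ.+-monoˡ-≤ (+ suc p ℤ.* + k) (ℚᵘ.drop-*≤* unnormalised))))
    where
    unnormalised : mkℚᵘ (+ ℓ) 0 ℚᵘ.* mkℚᵘ (+ r) 0 ℚᵘ.≤ (mkℚᵘ (+ 1) 0 ℚᵘ.+ ℚᵘ.- toℚᵘ ε) ℚᵘ.* mkℚᵘ (+ k) 0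
    unnormalised = ℚᵘ.≤-respˡ-≃ (ℚᵘ.≃-trans (ℚ.toℚᵘ-homo-* (ι ℓ) (ι r))
        (ℚᵘ.*-cong (ℚ.toℚᵘ-fromℚᵘ (mkℚᵘ (+ ℓ) 0)) (ℚ.toℚᵘ-fromℚᵘ (mkℚᵘ (+ r) 0))))
      (ℚᵘ.≤-respʳ-≃ (ℚᵘ.≃-trans (ℚ.toℚᵘ-homo-* (1ℚ - ε) (ι k))
        (ℚᵘ.*-cong (ℚᵘ.≃-trans (ℚ.toℚᵘ-homo-+ 1ℚ (- ε)) (ℚᵘ.+-congʳ (toℚᵘ 1ℚ) (ℚ.toℚᵘ-homo‿- ε)))
          (ℚ.toℚᵘ-fromℚᵘ (mkℚᵘ (+ k) 0)))) (ℚ.toℚᵘ-mono-≤ h))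
    1*q*1≡q : 1 ℕ.* q ℕ.* 1 ≡ q
    1*q*1≡q = trans (ℕ.*-identityʳ (1 ℕ.* q)) (ℕ.*-identityˡ q)
    left : (+ ℓ ℤ.* + r) ℤ.* + (1 ℕ.* q ℕ.* 1) ℤ.+ + suc p ℤ.* + k ≡ + (q ℕ.* (r ℕ.* ℓ) ℕ.+ suc p ℕ.* k)
    left = trans (cong (λ s → (+ ℓ ℤ.* + r) ℤ.* + s ℤ.+ + suc p ℤ.* + k) 1*q*1≡q)
      (trans (cong₂ ℤ._+_ (trans (reorder (+ ℓ) (+ r) (+ q)) (trans (cong (+ q ℤ.*_) (sym (ℤ.pos-* r ℓ))) (sym (ℤ.pos-* q (r ℕ.* ℓ)))))
        (sym (ℤ.pos-* (suc p) k))) (sym (ℤ.pos-+ (q ℕ.* (r ℕ.* ℓ)) (suc p ℕ.* k))))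
      where
      reorder : ∀ a b c → (a ℤ.* b) ℤ.* c ≡ c ℤ.* (b ℤ.* a)
      reorder = ℤ-Solver.solve-∀
    right : (+ 1 ℤ.* + q ℤ.+ (ℤ.- (+ suc p)) ℤ.* + 1) ℤ.* + k ℤ.* + 1 ℤ.+ + suc p ℤ.* + k ≡ + (q ℕ.* k)
    right = trans (simplify (+ q) (+ suc p) (+ k)) (sym (ℤ.pos-* q k))
      where
      simplify : ∀ q p k → (+ 1 ℤ.* q ℤ.+ (ℤ.- p) ℤ.* + 1) ℤ.* k ℤ.* + 1 ℤ.+ p ℤ.* k ≡ q ℤ.* k
      simplify = ℤ-Solver.solve-∀

-- Choice of parameters and conclusion

-- The square serves `z²-small` with a = 16rq², and 512r serves the rounding in `sparse-window`.
threshold : ℕ → ℕ → ℕ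
threshold r q = 16 ℕ.* r ℕ.* (q ℕ.* q) ℕ.* (16 ℕ.* r ℕ.* (q ℕ.* q)) ℕ.+ 512 ℕ.* r

module _ (r q k ℓ z : ℕ) (3≤r : 3 ≤ r) (0<q : 0 ℕ.< q)
  (K≤k : threshold r q ≤ k)
  (gap : q ℕ.* (r ℕ.* ℓ) ℕ.+ k ≤ q ℕ.* k)
  (z-lower : (8 ℕ.* (z ℕ.* z)) ℕ.^ r ℕ.< ℓ)
  {n : ℕ} (4k+2≤n : 4 ℕ.* k ℕ.+ 2 ≤ n) (G : Hypergraph n) (rank : RankAtMost r G)
  where

  open Anticoncentration G r rank ℓ

  512r≤k : 512 ℕ.* r ≤ k
  512r≤k = ℕ.≤-trans (ℕ.m≤n+m (512 ℕ.* r) (16 ℕ.* r ℕ.* (q ℕ.* q) ℕ.* (16 ℕ.* r ℕ.* (q ℕ.* q)))) K≤k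

  0<r : 0 ℕ.< r
  0<r = ℕ.≤-trans (s≤s z≤n) 3≤r

  0<k : 0 ℕ.< k
  0<k = ℕ.≤-trans (ℕ.*-mono-≤ (s≤s {n = 511} z≤n) 0<r) 512r≤k

  rℓ≤k : r ℕ.* ℓ ≤ k
  rℓ≤k = ℕ.*-cancelˡ-≤ q {{ℕ.>-nonZero 0<q}} (ℕ.≤-trans (ℕ.m≤m+n _ k) gap)

  ℓ≤k : ℓ ≤ k
  ℓ≤k = ℕ.≤-trans (ℕ.m≤n*m ℓ r {{ℕ.>-nonZero 0<r}}) rℓ≤k

  z*exact≤ : 0 ℕ.< z → z ℕ.* exact k ≤ 32 ℕ.* (n C k)
  z*exact≤ 0<z = anticoncentration k z 0<k 4k+2≤n params
    where
    open ℕ.≤-Reasoning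
    z²>0 : 0 ℕ.< z ℕ.* z
    z²>0 = ℕ.*-mono-≤ 0<z 0<z
    params : ∀ A → ∣ A ∣ ≡ k → edges A ≡ ℓ → ∃[ d ] ∃[ J ] (core A ℕ.+ d ≡ k × 0 ℕ.< J × k ℕ.* z ≤ 8 ℕ.* core A ℕ.* J ×
      8 ℕ.* (J ℕ.* J ℕ.* core A ℕ.* suc (suc r)) ≤ d ℕ.* d × 2 ℕ.* J ≤ d × 2 ℕ.* (J ℕ.* suc r) ≤ d)
    params A ∣A∣≡k edges≡ℓ with exists-window r q k z m d 3≤r 0<z 0<q m+d≡k k≤qd core-large
        (z²-small r (16 ℕ.* r ℕ.* (q ℕ.* q)) z k 3≤r (ℕ.≤-trans (ℕ.<⇒≤ z-lower) ℓ≤k) (ℕ.≤-trans (ℕ.m≤m+n _ _) K≤k)) 512r≤k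
      where
      m = core A
      d = k ℕ.∸ m
      m≤rℓ : m ≤ r ℕ.* ℓ
      m≤rℓ = subst (λ s → m ≤ r ℕ.* s) edges≡ℓ (core≤ A)
      m+d≡k : m ℕ.+ d ≡ k
      m+d≡k = ℕ.m+[n∸m]≡n (ℕ.≤-trans m≤rℓ rℓ≤k)
      k≤qd : k ≤ q ℕ.* d
      k≤qd = ℕ.+-cancelˡ-≤ (q ℕ.* m) _ _ (begin
        q ℕ.* m ℕ.+ k            ≤⟨ ℕ.+-monoˡ-≤ k (ℕ.*-monoʳ-≤ q m≤rℓ) ⟩
        q ℕ.* (r ℕ.* ℓ) ℕ.+ k    ≤⟨ gap ⟩
        q ℕ.* k                  ≡⟨ cong (q ℕ.*_) (sym m+d≡k) ⟩
        q ℕ.* (m ℕ.+ d)          ≡⟨ ℕ.*-distribˡ-+ q m d ⟩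
        q ℕ.* m ℕ.+ q ℕ.* d      ∎)
      -- A core of at most 2z²r vertices would leave room for at most (8z²)^r edges, fewer than `ℓ`.
      core-large : 2 ℕ.* (z ℕ.* z) ℕ.* r ≤ m
      core-large with ℕ.≤-total (2 ℕ.* (z ℕ.* z) ℕ.* r) m
      ... | inj₁ p = p
      ... | inj₂ p = contradiction z-lower (ℕ.≤⇒≯ (few-edges (z ℕ.* z) r m ℓ z²>0
        (subst (λ s → s ℕ.* (2 ℕ.* (z ℕ.* z)) ℕ.^ m ≤ (2 ℕ.* (z ℕ.* z)) ℕ.^ r ℕ.* suc (2 ℕ.* (z ℕ.* z)) ℕ.^ m) edges≡ℓ
          (edges≤ A (2 ℕ.* (z ℕ.* z)) (ℕ.≤-trans z²>0 (ℕ.m≤m+n _ _)))) p))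
    ... | J , w = k ℕ.∸ core A , J , ℕ.m+[n∸m]≡n (ℕ.≤-trans (subst (λ s → core A ≤ r ℕ.* s) edges≡ℓ (core≤ A)) rℓ≤k) , w

  exact*3[1+z]≤ : exact k ℕ.* (3 ℕ.* suc z) ≤ 100 ℕ.* (n C k)
  exact*3[1+z]≤ with z ℕ.≤? 32
  -- For these `z`, including z = 0, the bound 100 / (3(z + 1)) is above 1 and says nothing.
  ... | yes z≤32 = begin
    exact k ℕ.* (3 ℕ.* suc z)       ≤⟨ ℕ.*-mono-≤ (exact≤ k) (ℕ.*-monoʳ-≤ 3 (s≤s z≤32)) ⟩
    (n C k) ℕ.* 99                  ≤⟨ ℕ.*-monoʳ-≤ (n C k) (ℕ.n≤1+n 99) ⟩
    (n C k) ℕ.* 100                 ≡⟨ ℕ.*-comm (n C k) 100 ⟩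
    100 ℕ.* (n C k)                 ∎
    where open ℕ.≤-Reasoning
  -- Now z + 1 ≤ (34/33)z, so 32 / z is small enough because 3 · 34 · 32 = 3264 ≤ 33 · 100.
  ... | no z≰32 = ℕ.*-cancelˡ-≤ 33 (begin
    33 ℕ.* (exact k ℕ.* (3 ℕ.* suc z))         ≡⟨ lem₁ (exact k) z ⟩
    3 ℕ.* exact k ℕ.* (33 ℕ.* z ℕ.+ 33)        ≤⟨ ℕ.*-monoʳ-≤ (3 ℕ.* exact k) (ℕ.+-monoʳ-≤ (33 ℕ.* z) z>32) ⟩
    3 ℕ.* exact k ℕ.* (33 ℕ.* z ℕ.+ z)         ≡⟨ lem₂ (exact k) z ⟩
    102 ℕ.* (z ℕ.* exact k)                    ≤⟨ ℕ.*-monoʳ-≤ 102 (z*exact≤ (ℕ.≤-trans (s≤s z≤n) z>32)) ⟩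
    102 ℕ.* (32 ℕ.* (n C k))                   ≡⟨ sym (ℕ.*-assoc 102 32 (n C k)) ⟩
    3264 ℕ.* (n C k)                           ≤⟨ ℕ.*-monoˡ-≤ (n C k) {3264} {3300} (ℕ.m≤m+n 3264 36) ⟩
    3300 ℕ.* (n C k)                           ≡⟨ ℕ.*-assoc 33 100 (n C k) ⟩
    33 ℕ.* (100 ℕ.* (n C k))                   ∎)
    where
    open ℕ.≤-Reasoning
    z>32 : 33 ≤ z
    z>32 = ℕ.≰⇒> z≰32
    lem₁ : ∀ e z → 33 ℕ.* (e ℕ.* (3 ℕ.* suc z)) ≡ 3 ℕ.* e ℕ.* (33 ℕ.* z ℕ.+ 33)
    lem₁ = solve-∀
    lem₂ : ∀ e z → 3 ℕ.* e ℕ.* (33 ℕ.* z ℕ.+ z) ≡ 102 ℕ.* (z ℕ.* e)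
    lem₂ = solve-∀

  I≤ : I G k ℓ ≤ℚ (+ 100) / (3 ℕ.* suc z)
  I≤ = ratio≤ _ (n C k) 100 (z ℕ.+ 2 ℕ.* suc z)
    (subst (λ s → s ℕ.* (3 ℕ.* suc z) ≤ 100 ℕ.* (n C k)) (sym (exact-count k)) exact*3[1+z]≤)

-- Replacing √8 by 3 makes the bound 100 / (3(z + 1)) rational.
[8y²]^r≤[3y]^2r : ∀ y r → (8 ℕ.* (y ℕ.* y)) ℕ.^ r ≤ (3 ℕ.* y) ℕ.^ (2 ℕ.* r)
[8y²]^r≤[3y]^2r y r = ℕ.≤-trans (ℕ.^-monoˡ-≤ r (ℕ.≤-trans (ℕ.m≤n+m _ (y ℕ.* y)) (ℕ.≤-reflexive (lem y))))
  (ℕ.≤-reflexive (ℕ.^-*-assoc (3 ℕ.* y) 2 r))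
  where
  lem : ∀ y → y ℕ.* y ℕ.+ 8 ℕ.* (y ℕ.* y) ≡ 3 ℕ.* y ℕ.* (3 ℕ.* y ℕ.* 1)
  lem = solve-∀

theorem1p5 : (r : ℕ) → 3 ≤ r → (ε : ℚ) → 0ℚ < ε →
    ∃[ K ] (∀ (k : ℕ) → K ≤ k →
    ∀ (ℓ : ℕ) → 1 ≤ ℓ → ι ℓ * ι r ≤ℚ (1ℚ - ε) * ι k →
    IndUniformLeIndAtMost r k ℓ × IndAtMostBound r k ℓ)
theorem1p5 r 3≤r ε 0<ε with clear-denominator ε 0<ε
... | q , 0<q , clear = threshold r q , λ k K≤k ℓ 1≤ℓ ℓr≤ →
  -- An r-uniform hypergraph has rank at most r, so `G` is its own competitor, with n = m.
  (λ δ 0<δ m k≤m → m , k≤m , λ G uniform → G , (λ s e → ℕ.≤-reflexive (uniform s e)) , p≤p+δ (I G k ℓ) 0<δ) ,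
  -- The bound already holds at n = 4k + 2, so `δ` is mere slack.
  (λ δ 0<δ → 4 ℕ.* k ℕ.+ 2 , ℕ.≤-trans (ℕ.m≤n*m k 4) (ℕ.m≤m+n _ 2) , λ G rank → bound k K≤k ℓ 1≤ℓ (clear k ℓ r ℓr≤) δ 0<δ G rank)
  where
  bound : ∀ k → threshold r q ≤ k →
    ∀ ℓ → 1 ≤ ℓ → q ℕ.* (r ℕ.* ℓ) ℕ.+ k ≤ q ℕ.* k → ∀ δ → 0ℚ < δ →
    (G : Hypergraph (4 ℕ.* k ℕ.+ 2)) → RankAtMost r G → ∃[ x ] (BelowBound r ℓ x × (I G k ℓ ≤ℚ x + δ))
  bound k K≤k ℓ 1≤ℓ gap δ 0<δ G rank with root-bracket r ℓ (ℕ.≤-trans (s≤s z≤n) 3≤r) 1≤ℓ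
  ... | z , z-lower , z-upper = (+ 100) / (3 ℕ.* suc z) ,
    belowBound r ℓ (z ℕ.+ 2 ℕ.* suc z) (ℕ.≤-trans z-upper ([8y²]^r≤[3y]^2r (suc z) r)) ,
    ℚ.≤-trans (I≤ r q k ℓ z 3≤r 0<q K≤k gap z-lower ℕ.≤-refl G rank) (p≤p+δ _ 0<δ)
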